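{- Let $G$ be a bipartite graph. Then $G$ is matching double covered if and only if $G$ is (isomorphic to) $K_{3,3}$ or $C_4^4$.
   Context: Graphs are finite, loopless, and may have parallel edges (parallel edges are distinct edges, so perfect matchings differing only by the choice of a parallel edge are different). All graphs considered admit a perfect matching (in particular have at least one edge). A connected graph is matching double covered if every edge belongs to exactly two perfect matchings. $C_4^4$ is the graph obtained from the $4$-cycle by replacing every edge by two parallel edges. $K_{3,3}$ is the complete bipartite graph. -}

module Defs where

open import Data.Bool.Base using (Bool)
open import Data.Fin.Base using (Fin; quotient; remQuot; _↑ˡ_; _↑ʳ_)
open import Data.Fin.Patterns using (0F; 1F; 2F; 3F)
open import Data.Fin.Properties using (_≟_; all?)
open import Data.Fin.Subset using (Subset; _∈_)
open import Data.Nat.Base using (ℕ; NonZero; _*_)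
open import Data.Product using (Σ-syntax; ∃; ∃!; ∃-syntax; _×_; _,_; proj₁; proj₂; map; swap)
open import Data.Sum.Base using (_⊎_)
open import Function.Bundles using (_↔_; Inverse)
open import Relation.Binary.Construct.Closure.ReflexiveTransitive using (Star)
open import Relation.Binary.PropositionalEquality using (_≡_; _≢_)
open import Relation.Nullary.Decidable using (¬?; from-yes)

-- A finite non-null loopless multigraph.  `ends` lists the two ends of an edge
-- in an arbitrary order; every notion below is insensitive to that order.
record Graph : Set where
  field
    order    : ℕ
    size     : ℕ
    nonNull  : NonZero order
    ends     : Fin size → Fin order × Fin order
    loopless : ∀ e → proj₁ (ends e) ≢ proj₂ (ends e)

  Vertex : Set
  Vertex = Fin order

  Edge : Set
  Edge = Fin size

  Incident : Vertex → Edge → Set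
  Incident v e = v ≡ proj₁ (ends e) ⊎ v ≡ proj₂ (ends e)

  Adjacent : Vertex → Vertex → Set
  Adjacent u v = ∃[ e ] (ends e ≡ (u , v) ⊎ ends e ≡ (v , u))

  Connected : Set
  Connected = ∀ u v → Star Adjacent u v

  Bipartite : Set
  Bipartite = Σ[ side ∈ (Vertex → Bool) ]
    (∀ e → side (proj₁ (ends e)) ≢ side (proj₂ (ends e)))

  -- Matchings are sets of edges, so parallel edges give different matchings.
  PerfectMatching : Subset size → Set
  PerfectMatching M = ∀ v → ∃! _≡_ λ e → e ∈ M × Incident v e

  HasPerfectMatching : Set
  HasPerfectMatching = ∃ PerfectMatching

  PerfectMatchingThrough : Edge → Subset size → Set
  PerfectMatchingThrough e M = PerfectMatching M × e ∈ M

  InExactlyTwoPerfectMatchings : Edge → Set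
  InExactlyTwoPerfectMatchings e = ∃[ M ] ∃[ N ]
    ( M ≢ N
    × PerfectMatchingThrough e M
    × PerfectMatchingThrough e N
    × (∀ P → PerfectMatchingThrough e P → P ≡ M ⊎ P ≡ N))

  MatchingDoubleCovered : Set
  MatchingDoubleCovered = Connected × (∀ e → InExactlyTwoPerfectMatchings e)

infix 4 _≅_

record _≅_ (G H : Graph) : Set where
  private
    module G = Graph G
    module H = Graph H
  field
    vertices : G.Vertex ↔ H.Vertex
    edges    : G.Edge ↔ H.Edge

  mapVertex : G.Vertex → H.Vertex
  mapVertex = Inverse.to vertices

  mapEdge : G.Edge → H.Edge
  mapEdge = Inverse.to edges

  field
    preservesEnds : ∀ e →
      let uv = map mapVertex mapVertex (G.ends e) in
      H.ends (mapEdge e) ≡ uv ⊎ H.ends (mapEdge e) ≡ swap uv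

-- Sides {0,1,2} and {3,4,5}; the nine edges are indexed by Fin 3 × Fin 3.
K₃,₃ : Graph
K₃,₃ = record
  { order    = 6
  ; size     = 9
  ; nonNull  = _
  ; ends     = ends
  ; loopless = from-yes (all? λ e → ¬? (proj₁ (ends e) ≟ proj₂ (ends e)))
  }
  where
  ends : Fin 9 → Fin 6 × Fin 6
  ends e = map (_↑ˡ 3) (3 ↑ʳ_) (remQuot {3} 3 e)

C₄ : Graph
C₄ = record
  { order    = 4
  ; size     = 4
  ; nonNull  = _
  ; ends     = ends
  ; loopless = from-yes (all? λ e → ¬? (proj₁ (ends e) ≟ proj₂ (ends e)))
  }
  where
  ends : Fin 4 → Fin 4 × Fin 4
  ends 0F = 0F , 1F
  ends 1F = 1F , 2F
  ends 2F = 2F , 3F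
  ends 3F = 3F , 0F

-- Replaces every edge by two parallel edges: 2i and 2i+1 are the copies of i.
doubleEdges : Graph → Graph
doubleEdges G = record
  { order    = order
  ; size     = size * 2
  ; nonNull  = nonNull
  ; ends     = λ e → ends (quotient 2 e)
  ; loopless = λ e → loopless (quotient 2 e)
  }
  where open Graph G

C₄⁴ : Graph
C₄⁴ = doubleEdges C₄

module Submission where

open import Axiom.UniquenessOfIdentityProofs using (module Decidable⇒UIP)
open import Data.Bool.Base using (Bool; true; false)
import Data.Bool.Properties as Bool
open import Data.Fin.Base using (Fin; zero; suc; toℕ; fromℕ<; combine; opposite; quotient; remQuot)
open import Data.Fin.Patterns using (0F; 1F; 2F; 3F)
import Data.Fin.Properties as Fin
open import Data.Fin.Subset using (Subset; _∈_; ⁅_⁆; _∪_)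
open import Data.Fin.Subset.Properties using (_∈?_; anySubset?; ⊆-antisym)
open import Data.Nat.Base using (ℕ; zero; suc; NonZero; _+_)
open import Data.Nat.DivMod using (_%_)
open import Data.Nat.GeneralisedArithmetic using (fold; fold-+)
import Data.Nat.Properties as ℕ
open import Data.Product using (Σ; ∃; ∃₂; ∃-syntax; _×_; _,_; proj₁; proj₂; map; swap)
import Data.Product.Properties as Product
open import Data.Sum.Base using (_⊎_; inj₁; inj₂; [_,_]′)
open import Data.Vec.Base using (lookup; tabulate)
open import Data.Vec.Properties using (≡-dec; lookup∘tabulate; []=⇒lookup; lookup⇒[]=; tabulate-cong)
open import Function.Base using (_∘_)
open import Function.Bundles using (_⇔_; mk⇔; _↔_; mk↔ₛ′; Injection; Inverse)
open import Function.Definitions using (Injective)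
open import Function.Properties.Inverse using (↔-sym; ↔-trans; ↔⇒↣)
open import Relation.Binary.Construct.Closure.ReflexiveTransitive using (Star; ε; _◅_; gmap)
open import Relation.Binary.Definitions using (DecidableEquality)
open import Relation.Binary.PropositionalEquality
  using (_≡_; _≢_; _≗_; refl; sym; trans; cong; cong₂; subst; subst₂; module ≡-Reasoning)
open import Relation.Nullary using (¬_; Dec; yes; no; does; contradiction)
open import Relation.Nullary.Decidable
  using (_×-dec_; _⊎-dec_; _→-dec_; ¬?; dec-true; decidable-stable; from-yes; map′)
open import Relation.Unary using (Decidable)
open import Defs

-- Fix a perfect matching and contract its edges: G becomes a digraph whose nodes
-- are the contracted edges, and perfect matchings become families of disjoint
-- directed cycles (a selection picks an out-edge at every node, the matching edge ι v
-- where no cycle passes).  Double covering says that for every node x exactly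
-- one cycle η x avoids x, and each η x is chordless.  Call x ∼ y when η x
-- avoids y; then η x = η y, so ∼ is an equivalence and η x visits all nodes
-- outside the class of x.  Four classes are impossible, since an out-edge would
-- be shared by three cycles.  With three classes there is a cycle through all
-- nodes that rotates through the classes; its chords close up shorter cycles,
-- which forces the classes to be singletons and gives K₃,₃.  With two classes a
-- cycle through all nodes crosses between them, and a second node in a class would
-- put one of its out-edges in three matchings; this leaves two nodes and C₄⁴.

-- Orbits of a self-map.

module _ {A : Set} where

  Periodic : (A → A) → A → Set
  Periodic f w = ∃ λ j → fold w f (suc j) ≡ w

  abstract
    fold-commute : ∀ (w : A) f i j → fold (fold w f i) f j ≡ fold (fold w f j) f i
    fold-commute w f i j = begin
      fold (fold w f i) f j ≡⟨ fold-+ w f j ⟨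
      fold w f (j + i)      ≡⟨ cong (fold w f) (ℕ.+-comm j i) ⟩
      fold w f (i + j)      ≡⟨ fold-+ w f i ⟩
      fold (fold w f j) f i ∎
      where open ≡-Reasoning

    fold-injective : ∀ {f : A → A} → Injective _≡_ _≡_ f →
      ∀ i {u v} → fold u f i ≡ fold v f i → u ≡ v
    fold-injective inj zero    eq = eq
    fold-injective inj (suc i) eq = fold-injective inj i (inj eq)

    periodic-iterate : ∀ {f : A → A} {w} → Periodic f w → ∀ i → Periodic f (fold w f i)
    periodic-iterate {f} {w} (j , eq) i =
      j , trans (fold-commute w f i (suc j)) (cong (λ u → fold u f i) eq)

    crossing : ∀ {P : A → Set} → Decidable P → ∀ {f : A → A} {w} i → P w → ¬ P (fold w f i) →
      ∃[ j ] P (fold w f j) × ¬ P (fold w f (suc j))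
    crossing P? zero    Pw ¬P = contradiction Pw ¬P
    crossing P? {f} {w} (suc i) Pw ¬P with P? (fold w f i)
    ... | yes Pi = i , Pi , ¬P
    ... | no ¬Pi = crossing P? i Pw ¬Pi

    -- As long as `u` has not been met, `f` and `g` agree at every point visited, so the two orbits
    -- run together until one of them, hence both, meets `u`.
    reroute : DecidableEquality A → ∀ {f g : A → A} {w u} →
      (∀ i → fold w f i ≢ u → g (fold w f i) ≡ f (fold w f i)) →
      ∀ i → fold w f i ≡ u → ∃[ j ] fold w g j ≡ u
    reroute _≟_ {f} {g} {w} {u} agree i hit = [ (λ h → h) , (λ eq → i , trans eq hit) ]′ (go i)
      where
      go : ∀ i → (∃[ j ] fold w g j ≡ u) ⊎ fold w g i ≡ fold w f i
      go zero = inj₂ refl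
      go (suc i) with go i | fold w f i ≟ u
      ... | inj₁ h  | _      = inj₁ h
      ... | inj₂ eq | yes at = inj₁ (i , trans eq at)
      ... | inj₂ eq | no ≢u  = inj₂ (trans (cong g eq) (agree i ≢u))

    module _ {n} {index : A → Fin n} (index-injective : Injective _≡_ _≡_ index) where

      eventually-periodic : ∀ f w → ∃[ i ] Periodic f (fold w f i)
      eventually-periodic f w
        with i , j , i<j , eq ← Fin.pigeonhole (ℕ.n<1+n n) (λ i → index (fold w f (toℕ i)))
        with k , j≡ ← ℕ.m≤n⇒∃[o]m+o≡n i<j
        = toℕ i , k , (begin
          fold (fold w f (toℕ i)) f (suc k) ≡⟨ fold-+ w f (suc k) ⟨
          fold w f (suc k + toℕ i)          ≡⟨ cong (fold w f ∘ suc) (ℕ.+-comm k (toℕ i)) ⟩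
          fold w f (suc (toℕ i) + k)        ≡⟨ cong (fold w f) j≡ ⟩
          fold w f (toℕ j)                  ≡⟨ index-injective eq ⟨
          fold w f (toℕ i)                  ∎)
        where open ≡-Reasoning

      -- The pigeonhole principle makes some iterate of `w` periodic; injectivity cancels the steps
      -- leading up to it.
      injective⇒periodic : ∀ {f} → Injective _≡_ _≡_ f → ∀ w → Periodic f w
      injective⇒periodic {f} inj w = cancel (eventually-periodic f w)
        where
        cancel : (∃[ i ] Periodic f (fold w f i)) → Periodic f w
        cancel (i , j , eq) = j , fold-injective inj i {fold w f (suc j)} {w}
          (trans (fold-commute w f (suc j) i) eq)

-- Cycle families in a digraph.

module Selections {Node Edge : Set} (s t : Edge → Node) where

  step : (Node → Edge) → Node → Node
  step p = t ∘ p

  -- On finitely many nodes injectivity makes `step p` a permutation, whose orbits are the directed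
  -- cycles of the family, loops included.
  record Selection (p : Node → Edge) : Set where
    field
      source    : ∀ v → s (p v) ≡ v
      injective : Injective _≡_ _≡_ (step p)

  Through : Edge → (Node → Edge) → Set
  Through e p = Selection p × p (s e) ≡ e

  InExactlyTwo : Edge → Set
  InExactlyTwo e = ∃₂ λ a b → ¬ a ≗ b × Through e a × Through e b ×
    (∀ {p} → Through e p → p ≗ a ⊎ p ≗ b)

  Joins : Edge → Node → Node → Set
  Joins e u v = (s e ≡ u × t e ≡ v) ⊎ (s e ≡ v × t e ≡ u)

  -- Coordinates for the digraph with `m` edges from each of `n` nodes to each node, itself
  -- included. Contracting a perfect matching turns K₃,₃ into the case `3 1` and C₄⁴ into the case
  -- `2 2`.
  record Table (n m : ℕ) : Set where
    field
      node            : Fin n → Node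
      node-injective  : Injective _≡_ _≡_ node
      node-surjective : ∀ v → ∃ λ i → node i ≡ v
      edge            : Fin n → Fin n → Fin m → Edge
      edge-source     : ∀ i j k → s (edge i j k) ≡ node i
      edge-target     : ∀ i j k → t (edge i j k) ≡ node j
      edge-injective  : ∀ i j → Injective _≡_ _≡_ (edge i j)
      edge-surjective : ∀ e → ∃ λ i → ∃ λ j → ∃ λ k → edge i j k ≡ e

  crossing-edge : ∀ {P : Node → Set} → Decidable P → ∀ {u v} →
    Star (λ a b → ∃ λ e → Joins e a b) u v → P u → ¬ P v →
    ∃ λ e → (P (s e) × ¬ P (t e)) ⊎ (¬ P (s e) × P (t e))
  crossing-edge P? ε Pu ¬Pv = contradiction Pu ¬Pv
  crossing-edge P? (_◅_ {j = w} (e , joins) path) Pu ¬Pv with P? w | joins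
  ... | yes Pw | _                    = crossing-edge P? path Pw ¬Pv
  ... | no ¬Pw | inj₁ (refl , refl)   = e , inj₁ (Pu , ¬Pw)
  ... | no ¬Pw | inj₂ (refl , refl)   = e , inj₂ (¬Pw , Pu)

-- Double covered digraphs with a chosen loop at every node.

module DoubleCovered
  {Node Edge : Set} (_≟ᴺ_ : DecidableEquality Node) (_≟ᴱ_ : DecidableEquality Edge)
  (search : ∀ {P : Node → Set} → Decidable P → Dec (∃ P))
  {N} {index : Node → Fin N} (index-injective : Injective _≡_ _≡_ index)
  (s t : Edge → Node)
  (ι : Node → Edge) (s-ι : ∀ v → s (ι v) ≡ v) (t-ι : ∀ v → t (ι v) ≡ v)
  (two : ∀ e → Selections.InExactlyTwo s t e)
  where

  open Selections s t

  ι-selection : Selection ι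
  ι-selection = record
    { source    = s-ι
    ; injective = λ {u} {v} eq → trans (sym (t-ι u)) (trans eq (t-ι v))
    }

  -- All three pass through the edge `p v`, and up to pointwise equality only two selections do.
  three-through : ∀ {p q r} v → Selection p → Selection q → Selection r →
    q v ≡ p v → r v ≡ p v → p ≗ q ⊎ p ≗ r ⊎ q ≗ r
  three-through {p} {q} {r} v P Q R qv rv
    with a , b , _ , _ , _ , only ← two (p v)
    with only (P , cong p s≡) | only (Q , trans (cong q s≡) qv) | only (R , trans (cong r s≡) rv)
    where s≡ = Selection.source P v
  ... | inj₁ pa | inj₁ qa | _       = inj₁ λ u → trans (pa u) (sym (qa u))
  ... | inj₁ pa | inj₂ qb | inj₁ ra = inj₂ (inj₁ λ u → trans (pa u) (sym (ra u)))
  ... | inj₁ pa | inj₂ qb | inj₂ rb = inj₂ (inj₂ λ u → trans (qb u) (sym (rb u)))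
  ... | inj₂ pb | inj₂ qb | _       = inj₁ λ u → trans (pb u) (sym (qb u))
  ... | inj₂ pb | inj₁ qa | inj₂ rb = inj₂ (inj₁ λ u → trans (pb u) (sym (rb u)))
  ... | inj₂ pb | inj₁ qa | inj₁ ra = inj₂ (inj₂ λ u → trans (qa u) (sym (ra u)))

  agree? : ∀ p q → Dec (p ≗ q)
  agree? p q with search (λ v → ¬? (p v ≟ᴱ q v))
  ... | yes (v , p≢q) = no λ p≗q → p≢q (p≗q v)
  ... | no none       = yes λ v → decidable-stable (p v ≟ᴱ q v) λ p≢q → none (v , p≢q)

  abstract
    -- Of the two selections through `e` at most one agrees with `p`. Taken at `ι` this yields `η`;
    -- taken at some `η y` it yields a further selection through an edge of that cycle.
    another-through : ∀ e p → ∃ λ q → Through e q × ¬ p ≗ q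
    another-through e p with a , b , a≉b , A , B , _ ← two e with agree? p a
    ... | no p≉a  = a , A , p≉a
    ... | yes p≗a = b , B , λ p≗b → a≉b λ v → trans (sym (p≗a v)) (p≗b v)

  -- `ι` is one of the two selections through the loop `ι x`; this is the other.
  η : Node → Node → Edge
  η x = proj₁ (another-through (ι x) ι)

  η-selection : ∀ x → Selection (η x)
  η-selection x = proj₁ (proj₁ (proj₂ (another-through (ι x) ι)))

  η-fixes : ∀ x → η x x ≡ ι x
  η-fixes x = trans (cong (η x) (sym (s-ι x))) (proj₂ (proj₁ (proj₂ (another-through (ι x) ι))))

  η-nontrivial : ∀ x → ¬ ι ≗ η x
  η-nontrivial x = proj₂ (proj₂ (another-through (ι x) ι))

  -- `ι`, `η x` and `p` all pass through the loop `ι x`, and `ι` differs from the other two.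
  η-unique : ∀ {p} x → Selection p → p x ≡ ι x → ∀ {u} → p u ≢ ι u → η x ≗ p
  η-unique {p} x P px {u} pu with three-through x ι-selection (η-selection x) P (η-fixes x) px
  ... | inj₁ ι≗η        = contradiction ι≗η (η-nontrivial x)
  ... | inj₂ (inj₁ ι≗p) = contradiction (sym (ι≗p u)) pu
  ... | inj₂ (inj₂ η≗p) = η≗p

  -- The equivalence relation on nodes.

  infix 4 _∼_ _≁_ _∼?_

  _∼_ _≁_ : Node → Node → Set
  x ∼ y = η x y ≡ ι y
  x ≁ y = ¬ x ∼ y

  _∼?_ : ∀ x y → Dec (x ∼ y)
  x ∼? y = η x y ≟ᴱ ι y

  ∼-refl : ∀ {x} → x ∼ x
  ∼-refl {x} = η-fixes x

  η-moves : ∀ x → ∃ λ u → x ≁ u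
  η-moves x with search (λ u → ¬? (x ∼? u))
  ... | yes moved = moved
  ... | no none   = contradiction
    (λ u → sym (decidable-stable (x ∼? u) λ x≁u → none (u , x≁u))) (η-nontrivial x)

  -- `η x` is a nontrivial selection taking the loop at `y`, and there is only one such selection.
  -- Symmetry and transitivity of `∼` rest on this.
  ∼⇒≗ : ∀ {x y} → x ∼ y → η y ≗ η x
  ∼⇒≗ {x} {y} x∼y = η-unique y (η-selection x) x∼y (proj₂ (η-moves x))

  ∼-sym : ∀ {x y} → x ∼ y → y ∼ x
  ∼-sym {x} x∼y = trans (∼⇒≗ x∼y x) (η-fixes x)

  ∼-trans : ∀ {x y z} → x ∼ y → y ∼ z → x ∼ z
  ∼-trans {z = z} x∼y y∼z = trans (sym (∼⇒≗ x∼y z)) y∼z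

  ≗⇒∼ : ∀ {x y} → η x ≗ η y → x ∼ y
  ≗⇒∼ {y = y} eq = trans (eq y) (η-fixes y)

  ≁-sym : ∀ {x y} → x ≁ y → y ≁ x
  ≁-sym x≁y y∼x = x≁y (∼-sym y∼x)

  separated : ∀ {x y z} → x ∼ y → x ≁ z → y ≁ z
  separated x∼y x≁z y∼z = x≁z (∼-trans x∼y y∼z)

  -- If `p` took the loop at the next node, that node would be entered both from itself and from
  -- `v`; injectivity would identify the two.
  step-moved : ∀ {p} → Selection p → ∀ {v} → p v ≢ ι v → p (step p v) ≢ ι (step p v)
  step-moved {p} P {v} pv eq = pv (subst (λ u → p u ≡ ι u) fixed eq)
    where
    fixed : step p v ≡ v
    fixed = Selection.injective P (trans (cong t eq) (t-ι _))

  orbit-moved : ∀ {p} → Selection p → ∀ {v} → p v ≢ ι v →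
    ∀ i → p (fold v (step p) i) ≢ ι (fold v (step p) i)
  orbit-moved P pv zero    = pv
  orbit-moved P pv (suc i) = step-moved P (orbit-moved P pv i)

  step-≁ : ∀ {x v} → x ≁ v → x ≁ step (η x) v
  step-≁ {x} = step-moved (η-selection x)

  -- Directed cycles cut out of choice functions.

  record CycleOf (g : Node → Edge) (w : Node) : Set where
    field
      cycle     : Node → Edge
      selection : Selection cycle
      on        : ∀ i → cycle (fold w (step g) i) ≡ g (fold w (step g) i)
      off       : ∀ v → (∃[ i ] fold w (step g) i ≡ v) ⊎ cycle v ≡ ι v

    on-or-off : ∀ v → cycle v ≡ g v ⊎ cycle v ≡ ι v
    on-or-off v with off v
    ... | inj₁ (i , refl) = inj₁ (on i)
    ... | inj₂ eq         = inj₂ eq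

    reached : ∀ {v} → cycle v ≢ ι v → ∃[ i ] fold w (step g) i ≡ v
    reached {v} moved with off v
    ... | inj₁ hit = hit
    ... | inj₂ eq  = contradiction eq moved

  -- A choice function with a periodic point carries a directed cycle: on the
  -- orbit the step function is invertible, whatever it does elsewhere.
  abstract
    cycleOf : ∀ {g w} → (∀ v → s (g v) ≡ v) → Periodic (step g) w → CycleOf g w
    cycleOf {g} {w} source (j , period) = record
      { cycle     = cycle
      ; selection = record { source = cycle-source ; injective = cycle-injective }
      ; on        = λ i → on-orbit (orbit i)
      ; off       = off
      }
      where
      f : Node → Node
      f = step g

      Orbit : Node → Set
      Orbit v = ∃ λ (i : Fin (suc j)) → fold w f (toℕ i) ≡ v

      orbit? : Decidable Orbit
      orbit? v = Fin.any? λ i → fold w f (toℕ i) ≟ᴺ v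

      orbit-step : ∀ {v} → Orbit v → Orbit (f v)
      orbit-step (i , refl) with suc (toℕ i) ℕ.<? suc j
      ... | yes 1+i<1+j = fromℕ< 1+i<1+j , cong (fold w f) (Fin.toℕ-fromℕ< 1+i<1+j)
      -- At the last index the orbit closes up, so the next point is the start.
      ... | no  1+i≮1+j = zero , trans (sym period) (cong (fold w f) (ℕ.≤-antisym (ℕ.≮⇒≥ 1+i≮1+j) (Fin.toℕ<n i)))

      orbit : ∀ i → Orbit (fold w f i)
      orbit zero    = zero , refl
      orbit (suc i) = orbit-step (orbit i)

      orbit-periodic : ∀ {v} → Orbit v → fold v f (suc j) ≡ v
      orbit-periodic (i , refl) = proj₂ (periodic-iterate (j , period) (toℕ i))

      cycle : Node → Edge
      cycle v with orbit? v
      ... | yes _ = g v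
      ... | no  _ = ι v

      on-orbit : ∀ {v} → Orbit v → cycle v ≡ g v
      on-orbit {v} o with orbit? v
      ... | yes _ = refl
      ... | no ¬o = contradiction o ¬o

      off : ∀ v → (∃[ i ] fold w f i ≡ v) ⊎ cycle v ≡ ι v
      off v with orbit? v
      ... | yes (i , eq) = inj₁ (toℕ i , eq)
      ... | no  _        = inj₂ refl

      cycle-source : ∀ v → s (cycle v) ≡ v
      cycle-source v with orbit? v
      ... | yes _ = source v
      ... | no  _ = s-ι v

      fold-f : ∀ v i → fold (f v) f i ≡ fold v f (suc i)
      fold-f v i = fold-commute v f 1 i

      cycle-injective : Injective _≡_ _≡_ (step cycle)
      cycle-injective {u} {v} eq with orbit? u | orbit? v
      ... | yes o | yes o′ = begin
        u                 ≡⟨ orbit-periodic o ⟨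
        fold u f (suc j)  ≡⟨ fold-f u j ⟨
        fold (f u) f j    ≡⟨ cong (λ a → fold a f j) eq ⟩
        fold (f v) f j    ≡⟨ fold-f v j ⟩
        fold v f (suc j)  ≡⟨ orbit-periodic o′ ⟩
        v                 ∎
        where open ≡-Reasoning
      ... | yes o | no ¬o  = contradiction (subst Orbit (trans eq (t-ι v)) (orbit-step o)) ¬o
      ... | no ¬o | yes o  = contradiction (subst Orbit (trans (sym eq) (t-ι u)) (orbit-step o)) ¬o
      ... | no _  | no _   = trans (sym (t-ι u)) (trans eq (t-ι v))

  selection-periodic : ∀ {p} → Selection p → ∀ v → Periodic (step p) v
  selection-periodic P = injective⇒periodic index-injective (Selection.injective P)

  abstract
    -- The cycle takes the loop at `x`, whether or not `x` lies on the orbit, and the point with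
    -- index `i` shows that it is not `ι`.
    cycle≗η : ∀ {g w x} (c : CycleOf g w) → g x ≡ ι x →
      ∀ i → g (fold w (step g) i) ≢ ι (fold w (step g) i) → η x ≗ CycleOf.cycle c
    cycle≗η {x = x} c gx i moved = η-unique x selection fixes λ eq → moved (trans (sym (on i)) eq)
      where
      open CycleOf c
      fixes : cycle x ≡ ι x
      fixes with on-or-off x
      ... | inj₁ eq = trans eq gx
      ... | inj₂ eq = eq

    η-cycle : ∀ x u → CycleOf (η x) u
    η-cycle x u = cycleOf (Selection.source (η-selection x)) (selection-periodic (η-selection x) u)

    -- The cycle of `η x` through `u`, with loops elsewhere, is already a nontrivial selection
    -- taking the loop at `x`, hence all of `η x`. So `η x` consists of a single cycle and loops.
    η-transitive : ∀ {x u v} → x ≁ u → x ≁ v → ∃[ i ] fold u (step (η x)) i ≡ v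
    η-transitive {x} {u} {v} x≁u x≁v =
      CycleOf.reached (η-cycle x u) λ cv → x≁v (trans (cycle≗η (η-cycle x u) ∼-refl 0 x≁u v) cv)

  -- Redirecting a choice function along one edge; chords.

  abstract
    _[_≔_] : (Node → Edge) → Node → Edge → Node → Edge
    (g [ u ≔ e ]) v with v ≟ᴺ u
    ... | yes _ = e
    ... | no  _ = g v

    ≔-at : ∀ g u e → (g [ u ≔ e ]) u ≡ e
    ≔-at g u e with u ≟ᴺ u
    ... | yes _  = refl
    ... | no u≢u = contradiction refl u≢u

    ≔-away : ∀ g {u v} e → v ≢ u → (g [ u ≔ e ]) v ≡ g v
    ≔-away g {u} {v} e v≢u with v ≟ᴺ u
    ... | yes v≡u = contradiction v≡u v≢u
    ... | no  _   = refl

    ≔-source : ∀ g {u e} → (∀ v → s (g v) ≡ v) → s e ≡ u → ∀ v → s ((g [ u ≔ e ]) v) ≡ v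
    ≔-source g {u} source se v with v ≟ᴺ u
    ... | yes v≡u = trans se (sym v≡u)
    ... | no  _   = source v

  -- Closing the path of g from t e to s e by the edge e.
  abstract
    ≔-cycle : ∀ {g} e → (∀ v → s (g v) ≡ v) → ∀ i → fold (t e) (step g) i ≡ s e →
      Σ (CycleOf (g [ s e ≔ e ]) (t e)) λ c → CycleOf.cycle c (s e) ≡ e ×
      ∃[ j ] fold (t e) (step (g [ s e ≔ e ])) j ≡ s e
    ≔-cycle {g} e source i hit
      with j , at ← reroute _≟ᴺ_ (λ k ≢se → cong t (≔-away g e ≢se)) i hit
      = c , trans (subst (λ v → CycleOf.cycle c v ≡ g′ v) at (CycleOf.on c j)) (≔-at g (s e) e) , j , at
      where
      g′ : Node → Edge
      g′ = g [ s e ≔ e ]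
      c : CycleOf g′ (t e)
      c = cycleOf (≔-source g source refl) (j , trans (cong (step g′) at) (cong t (≔-at g (s e) e)))

  ≔-nonbase : ∀ g {e} → (∀ v → g v ≢ ι v) → t e ≢ s e → ∀ v → (g [ s e ≔ e ]) v ≢ ι v
  ≔-nonbase g {e} nonbase t≢s v eq with v ≟ᴺ s e
  ... | yes refl = t≢s (trans (cong t (trans (sym (≔-at g v e)) eq)) (t-ι v))
  ... | no  v≢s  = nonbase v (trans (sym (≔-away g e v≢s)) eq)

  ≔-step : ∀ g e {v} → v ≢ s e → step (g [ s e ≔ e ]) v ≡ step g v
  ≔-step g e v≢s = cong t (≔-away g e v≢s)

  -- After the redirection `s e` enters `t e`, and every other node keeps its step, so another entry
  -- would break injectivity.
  ≔-selection⇒unique-entry : ∀ g e {p} → Selection p → p ≗ g [ s e ≔ e ] →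
    ∀ {u} → step g u ≡ t e → u ≡ s e
  ≔-selection⇒unique-entry g e {p} P p≗ {u} enters with u ≟ᴺ s e
  ... | yes u≡s = u≡s
  ... | no  u≢s = Selection.injective P (begin
    step p u                  ≡⟨ cong t (p≗ u) ⟩
    step (g [ s e ≔ e ]) u    ≡⟨ ≔-step g e u≢s ⟩
    step g u                  ≡⟨ enters ⟩
    t e                       ≡⟨ cong t (trans (p≗ (s e)) (≔-at g (s e) e)) ⟨
    step p (s e)              ∎)
    where open ≡-Reasoning

  -- The path of `η x` from `t e` to `s e`, closed by `e`, gives a nontrivial selection taking the
  -- loop at `x`. By uniqueness it is `η x`, which therefore takes `e`.
  η-chordless : ∀ {x} e → e ≢ ι (s e) → x ≁ s e → x ≁ t e → η x (s e) ≡ e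
  η-chordless {x} e nonbase x≁s x≁t
    with i , hit ← η-transitive x≁t x≁s
    with c , moves , j , at ← ≔-cycle e (Selection.source (η-selection x)) i hit
    = trans (cycle≗η c fixes j moved (s e)) moves
    where
    fixes : (η x [ s e ≔ e ]) x ≡ ι x
    fixes = trans (≔-away (η x) e λ { refl → x≁s ∼-refl }) ∼-refl
    w = fold (t e) (step (η x [ s e ≔ e ])) j
    moved : (η x [ s e ≔ e ]) w ≢ ι w
    moved rewrite at | ≔-at (η x) (s e) e = nonbase

  outside : ∀ {x y v} → x ≁ y → y ∼ v → x ≁ v
  outside x≁y y∼v x∼v = x≁y (∼-trans x∼v (∼-sym y∼v))

  η-nonbase : ∀ {x v} → x ≁ v → η x v ≢ ι (s (η x v))
  η-nonbase {x} {v} x≁v eq = x≁v (trans eq (cong ι (Selection.source (η-selection x) v)))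

  -- The edge `η y v` has both ends on the cycle of `η z`, which has no chords.
  η-agree : ∀ {y z v} → y ≁ v → z ≁ v → z ≁ step (η y) v → η z v ≡ η y v
  η-agree {y} {z} {v} y≁v z≁v z≁w =
    trans (cong (η z) (sym source)) (η-chordless (η y v) (η-nonbase y≁v) (subst (z ≁_) (sym source) z≁v) z≁w)
    where source = Selection.source (η-selection y) v

  agreeing-η : ∀ {y z w v} → y ≁ z → y ≁ w → z ≁ w → η z v ≡ η y v → η w v ≢ η y v
  agreeing-η {y} {z} {w} {v} y≁z y≁w z≁w zy wy
    with three-through v (η-selection y) (η-selection z) (η-selection w) zy wy
  ... | inj₁ eq        = y≁z (≗⇒∼ eq)
  ... | inj₂ (inj₁ eq) = y≁w (≗⇒∼ eq)
  ... | inj₂ (inj₂ eq) = z≁w (≗⇒∼ eq)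

  -- The edges chosen at x by the three other classes: each of them coincides with
  -- one of the other two, since its end misses one of the two classes.
  no-four-classes : ∀ {x y z w} → y ≁ x → z ≁ x → w ≁ x → y ≁ z → y ≁ w → ¬ z ≁ w
  no-four-classes {x} {y} {z} {w} y≁x z≁x w≁x y≁z y≁w z≁w =
    conclude (meets y≁x z≁x w≁x z≁w) (meets z≁x y≁x w≁x y≁w) (meets w≁x y≁x z≁x y≁z)
    where
    meets : ∀ {a b c} → a ≁ x → b ≁ x → c ≁ x → b ≁ c → η b x ≡ η a x ⊎ η c x ≡ η a x
    meets {a} {b} {c} a≁x b≁x c≁x b≁c with b ∼? step (η a) x
    ... | yes b∼ = inj₂ (η-agree a≁x c≁x λ c∼ → b≁c (∼-trans b∼ (∼-sym c∼)))
    ... | no b≁  = inj₁ (η-agree a≁x b≁x b≁)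

    absurd = agreeing-η {v = x} y≁z y≁w z≁w
    conclude : η z x ≡ η y x ⊎ η w x ≡ η y x → η y x ≡ η z x ⊎ η w x ≡ η z x →
      ¬ (η y x ≡ η w x ⊎ η z x ≡ η w x)
    conclude (inj₁ zy) _         (inj₁ yw) = absurd zy (sym yw)
    conclude (inj₁ zy) _         (inj₂ zw) = absurd zy (trans (sym zw) zy)
    conclude (inj₂ wy) (inj₁ yz) _         = absurd (sym yz) wy
    conclude (inj₂ wy) (inj₂ wz) _         = absurd (trans (sym wz) wy) wy

  -- Full selections and the case of three classes.

  Full : (Node → Edge) → Set
  Full p = ∀ v → p v ≢ ι v

  -- A nontrivial selection that still takes the loop at some `x` can only be `η x`.
  full? : ∀ {p} → Selection p → ∀ {u} → p u ≢ ι u → Full p ⊎ ∃ λ x → η x ≗ p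
  full? {p} P moved with search (λ v → p v ≟ᴱ ι v)
  ... | yes (x , fixed) = inj₂ (x , η-unique x P fixed moved)
  ... | no none         = inj₁ λ v eq → none (v , eq)

  module ThreeClasses {x y z : Node} (x≁y : x ≁ y) (x≁z : x ≁ z) (y≁z : y ≁ z)
    (cover : ∀ v → x ∼ v ⊎ y ∼ v ⊎ z ∼ v) where

    -- On its way from `x` to `z` the cycle `η y` has an edge from the class of `x` to that of `z`.
    -- A second selection through this edge is no `η c`: with `c` in the class of `x` it would take
    -- the loop at the source, with `c` in that of `z` it would avoid the target, and with `c` in
    -- that of `y` it would be `η y` again.
    exists-full : ∃ λ q → Selection q × Full q
    exists-full
      with i , x⇝z ← η-transitive {y} {x} {z} (≁-sym x≁y) y≁z
      with j , x∼v , x≁w ← crossing (x ∼?_) i ∼-refl (x≁z ∘ subst (x ∼_) x⇝z)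
      = go
      where
      v = fold x (step (η y)) j
      w = step (η y) v
      source = Selection.source (η-selection y) v
      y≁v = orbit-moved (η-selection y) {x} (≁-sym x≁y) j
      y≁w = step-≁ y≁v
      z∼w : z ∼ w
      z∼w with cover w
      ... | inj₁ x∼w        = contradiction x∼w x≁w
      ... | inj₂ (inj₁ y∼w) = contradiction y∼w y≁w
      ... | inj₂ (inj₂ z∼w) = z∼w
      go : ∃ λ q → Selection q × Full q
      go with q , (Q , through) , η≉q ← another-through (η y v) (η y)
        with qv ← trans (cong q (sym source)) through
        with full? Q {v} (λ qv≡ι → y≁v (trans (sym qv) qv≡ι))
      ... | inj₁ full = q , Q , full
      ... | inj₂ (c , η≗q) with cover c
      ...   | inj₁ x∼c = contradiction (trans (sym qv) (trans (sym (η≗q v)) (∼-trans (∼-sym x∼c) x∼v))) y≁v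
      ...   | inj₂ (inj₁ y∼c) = contradiction (λ u → trans (sym (∼⇒≗ y∼c u)) (η≗q u)) η≉q
      ...   | inj₂ (inj₂ z∼c) = contradiction (∼-trans (∼-sym z∼c) z∼w)
        (subst (λ a → c ≁ t a) (trans (η≗q v) qv) (step-≁ (separated z∼c λ z∼v → x≁z (∼-trans x∼v (∼-sym z∼v)))))

  module WithFull {q} (Q : Selection q) (full : Full q) where

    -- The target of `q v` misses the class of `y` or that of `z`, so by chordlessness `η y` or
    -- `η z` takes `q v`. If these two agreed at `v`, three different selections would share that
    -- edge.
    η-disagree : ∀ {y z v} → y ≁ v → z ≁ v → y ≁ z → η z v ≢ η y v
    η-disagree {y} {z} {v} y≁v z≁v y≁z zy
      with three-through v (η-selection y) (η-selection z) Q zy q≡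
      where
      source = Selection.source Q v
      chord : ∀ {c} → c ≁ v → c ≁ step q v → η c v ≡ q v
      chord {c} c≁v c≁w = trans (cong (η c) (sym source))
        (η-chordless (q v) (λ eq → full v (trans eq (cong ι source))) (subst (c ≁_) (sym source) c≁v) c≁w)
      q≡ : q v ≡ η y v
      q≡ with y ∼? step q v
      ... | no  y≁w = sym (chord y≁v y≁w)
      ... | yes y∼w = trans (sym (chord z≁v λ z∼w → y≁z (∼-trans y∼w (∼-sym z∼w)))) zy
    ... | inj₁ eq        = y≁z (≗⇒∼ eq)
    ... | inj₂ (inj₁ eq) = full y (trans (sym (eq y)) ∼-refl)
    ... | inj₂ (inj₂ eq) = full z (trans (sym (eq z)) ∼-refl)

    -- Otherwise `η z` would take the same edge at `v`. With three classes this makes each `η`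
    -- alternate between the two classes that it visits.
    η-crosses : ∀ {y z v} → y ≁ v → z ≁ v → y ≁ z → z ∼ step (η y) v
    η-crosses {y} {z} {v} y≁v z≁v y≁z with z ∼? step (η y) v
    ... | yes z∼w = z∼w
    ... | no  z≁w = contradiction (η-agree y≁v z≁v z≁w) (η-disagree y≁v z≁v y≁z)

    module Rotation {x y z : Node} (x≁y : x ≁ y) (x≁z : x ≁ z) (y≁z : y ≁ z)
      (cover : ∀ v → x ∼ v ⊎ y ∼ v ⊎ z ∼ v) where

      -- Every `η d` takes the loops of a whole class, so a selection that moves a node of each
      -- class is none of them.
      three-moved⇒full : ∀ {p} → Selection p → ∀ {a b c} → x ∼ a → y ∼ b → z ∼ c →
        p a ≢ ι a → p b ≢ ι b → p c ≢ ι c → Full p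
      three-moved⇒full P {a} {b} {c} x∼a y∼b z∼c pa pb pc with full? P pa
      ... | inj₁ full-p = full-p
      ... | inj₂ (d , same) with cover d
      ...   | inj₁ x∼d        = contradiction (trans (sym (same a)) (∼-trans (∼-sym x∼d) x∼a)) pa
      ...   | inj₂ (inj₁ y∼d) = contradiction (trans (sym (same b)) (∼-trans (∼-sym y∼d) y∼b)) pb
      ...   | inj₂ (inj₂ z∼d) = contradiction (trans (sym (same c)) (∼-trans (∼-sym z∼d) z∼c)) pc

      abstract
        -- In the cyclic order `x`, `y`, `z` each node uses the `η` of the preceding class, which by
        -- `η-crosses` leads into the following class.
        rotate : Node → Edge
        rotate v with cover v
        ... | inj₁ _        = η z v
        ... | inj₂ (inj₁ _) = η x v
        ... | inj₂ (inj₂ _) = η y v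

        rotate-x : ∀ {v} → x ∼ v → rotate v ≡ η z v
        rotate-x {v} x∼v with cover v
        ... | inj₁ _          = refl
        ... | inj₂ (inj₁ y∼v) = contradiction (∼-trans x∼v (∼-sym y∼v)) x≁y
        ... | inj₂ (inj₂ z∼v) = contradiction (∼-trans x∼v (∼-sym z∼v)) x≁z

        rotate-y : ∀ {v} → y ∼ v → rotate v ≡ η x v
        rotate-y {v} y∼v with cover v
        ... | inj₁ x∼v        = contradiction (∼-trans x∼v (∼-sym y∼v)) x≁y
        ... | inj₂ (inj₁ _)   = refl
        ... | inj₂ (inj₂ z∼v) = contradiction (∼-trans y∼v (∼-sym z∼v)) y≁z

        rotate-z : ∀ {v} → z ∼ v → rotate v ≡ η y v
        rotate-z {v} z∼v with cover v
        ... | inj₁ x∼v        = contradiction (∼-trans x∼v (∼-sym z∼v)) x≁z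
        ... | inj₂ (inj₁ y∼v) = contradiction (∼-trans y∼v (∼-sym z∼v)) y≁z
        ... | inj₂ (inj₂ _)   = refl

        rotate-source : ∀ v → s (rotate v) ≡ v
        rotate-source v with cover v
        ... | inj₁ _        = Selection.source (η-selection z) v
        ... | inj₂ (inj₁ _) = Selection.source (η-selection x) v
        ... | inj₂ (inj₂ _) = Selection.source (η-selection y) v

        rotate-nonbase : ∀ v → rotate v ≢ ι v
        rotate-nonbase v with cover v
        ... | inj₁ x∼v        = outside (≁-sym x≁z) x∼v
        ... | inj₂ (inj₁ y∼v) = outside x≁y y∼v
        ... | inj₂ (inj₂ z∼v) = outside y≁z z∼v

      π : Node → Node
      π = step rotate

      π-x : ∀ {v} → x ∼ v → y ∼ π v
      π-x x∼v = subst (λ e → y ∼ t e) (sym (rotate-x x∼v))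
        (η-crosses (outside (≁-sym x≁z) x∼v) (outside (≁-sym x≁y) x∼v) (≁-sym y≁z))

      π-y : ∀ {v} → y ∼ v → z ∼ π v
      π-y y∼v = subst (λ e → z ∼ t e) (sym (rotate-y y∼v))
        (η-crosses (outside x≁y y∼v) (outside (≁-sym y≁z) y∼v) x≁z)

      π-z : ∀ {v} → z ∼ v → x ∼ π v
      π-z z∼v = subst (λ e → x ∼ t e) (sym (rotate-z z∼v))
        (η-crosses (outside y≁z z∼v) (outside x≁z z∼v) (≁-sym x≁y))

      visits-x : ∀ (w : Node) → ∃ λ i → x ∼ fold w π i
      visits-x w with cover w
      ... | inj₁ x∼w        = 0 , x∼w
      ... | inj₂ (inj₁ y∼w) = 2 , π-z (π-y y∼w)
      ... | inj₂ (inj₂ z∼w) = 1 , π-z z∼w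

      module _ {w : Node} (c : CycleOf rotate w) where
        open CycleOf c

        -- Three consecutive points of the orbit meet all three classes, so the cycle is full and
        -- leaves out no node.
        rotation-reaches : ∀ v → ∃[ i ] fold w π i ≡ v
        rotation-reaches v with i , x∼ ← visits-x w =
          reached (three-moved⇒full selection x∼ (π-x x∼) (π-y (π-x x∼))
            (moved i) (moved (suc i)) (moved (suc (suc i))) v)
          where
          moved : ∀ i → cycle (fold w π i) ≢ ι (fold w π i)
          moved i eq = rotate-nonbase _ (trans (sym (on i)) eq)

      abstract
        -- Some iterate of `u` is periodic, and the cycle through it reaches every node, `u`
        -- included.
        rotation-periodic : ∀ u → Periodic π u
        rotation-periodic u = subst (Periodic π) (proj₂ back) (periodic-iterate {f = π} (proj₂ tail) (proj₁ back))
          where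
          tail : ∃[ i ] Periodic π (fold u π i)
          tail = eventually-periodic index-injective π u
          back : ∃[ j ] fold (fold u π (proj₁ tail)) π j ≡ u
          back = rotation-reaches (cycleOf rotate-source (proj₂ tail)) u

        rotation-transitive : ∀ u v → ∃[ i ] fold u π i ≡ v
        rotation-transitive u = rotation-reaches (cycleOf rotate-source (rotation-periodic u))

      -- Otherwise the rotation could be rerouted along e and would stay a full
      -- selection, although t e is already the successor of another node.
      rotation-backs : ∀ e → x ∼ s e → z ∼ t e → π (t e) ≡ s e
      rotation-backs e x∼s z∼t with π (t e) ≟ᴺ s e
      ... | yes back  = back
      ... | no  ¬back = contradiction (rotation-transitive (s e) (t e)) absurd
        where
        g : Node → Edge
        g = rotate [ s e ≔ e ]

        path = rotation-transitive (t e) (s e)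
        closed = ≔-cycle e rotate-source (proj₁ path) (proj₂ path)

        open CycleOf (proj₁ closed)

        t≢s : t e ≢ s e
        t≢s eq = outside (≁-sym x≁z) x∼s (subst (z ∼_) eq z∼t)

        moved : ∀ i → cycle (fold (t e) (step g) i) ≢ ι (fold (t e) (step g) i)
        moved i eq = ≔-nonbase rotate rotate-nonbase t≢s _ (trans (sym (on i)) eq)

        x∼1 : x ∼ step g (t e)
        x∼1 = subst (x ∼_) (sym (≔-step rotate e t≢s)) (π-z z∼t)

        y∼2 : y ∼ step g (step g (t e))
        -- By `¬back` this step does not start at `s e`, so `g` still follows the rotation here.
        y∼2 = subst (y ∼_) (sym (≔-step rotate e λ eq → ¬back (trans (sym (≔-step rotate e t≢s)) eq))) (π-x x∼1)

        full-cycle : Full cycle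
        full-cycle = three-moved⇒full selection x∼1 y∼2 z∼t (moved 1) (moved 2) (moved 0)

        cycle≗g : cycle ≗ g
        cycle≗g v with on-or-off v
        ... | inj₁ eq = eq
        ... | inj₂ eq = contradiction eq (full-cycle v)

        absurd : ¬ (∃[ i ] fold (s e) π i ≡ t e)
        absurd (zero  , eq) = t≢s (sym eq)
        -- The node from which the rotation enters `t e` would have to be `s e`, but the rotation
        -- leads from `s e` into the class of `y`.
        absurd (suc i , eq) = u≢s (≔-selection⇒unique-entry rotate e selection cycle≗g eq)
          where
          u≢s : fold (s e) π i ≢ s e
          u≢s u≡s = outside (≁-sym y≁z) (π-x x∼s) (subst (z ∼_) (trans (sym eq) (cong π u≡s)) z∼t)

      -- From `v` the cycle `η y` goes to a node in the class of `z`, where it coincides with the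
      -- rotation, and `rotation-backs` returns it to `v`. So it has length two, although it visits
      -- all of the class of `x`.
      x-singleton : ∀ {v v′} → x ∼ v → x ∼ v′ → v′ ≡ v
      x-singleton {v} {v′} x∼v x∼v′
        with i , refl ← η-transitive {y} {v} {v′} (outside (≁-sym x≁y) x∼v) (outside (≁-sym x≁y) x∼v′)
        with two-cycle i
        where
        w = step (η y) v
        source = Selection.source (η-selection y) v
        z∼w : z ∼ w
        z∼w = η-crosses (outside (≁-sym x≁y) x∼v) (outside (≁-sym x≁z) x∼v) y≁z
        back : step (η y) w ≡ v
        back = trans (cong t (sym (rotate-z z∼w)))
          (trans (rotation-backs (η y v) (subst (x ∼_) (sym source) x∼v) z∼w) source)
        two-cycle : ∀ i → fold v (step (η y)) i ≡ v ⊎ z ∼ fold v (step (η y)) i × fold v (step (η y)) i ≡ w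
        two-cycle zero = inj₁ refl
        two-cycle (suc i) with two-cycle i
        ... | inj₁ eq       = inj₂ (subst (z ∼_) (cong (step (η y)) (sym eq)) z∼w , cong (step (η y)) eq)
        ... | inj₂ (_ , eq) = inj₁ (trans (cong (step (η y)) eq) back)
      ... | inj₁ eq       = eq
      ... | inj₂ (z∼ , _) = contradiction (∼-trans x∼v′ (∼-sym z∼)) x≁z

  third : (i j : Fin 3) → ∃ λ k → k ≢ i × k ≢ j
  third = from-yes (Fin.all? {3} λ i → Fin.all? {3} λ j →
    Fin.any? {3} λ k → ¬? (k Fin.≟ i) ×-dec ¬? (k Fin.≟ j))

  three-classes⇒Table : (node : Fin 3 → Node) → (∀ {i j} → i ≢ j → node i ≁ node j) → Table 3 1
  three-classes⇒Table node apart = record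
    { node            = node
    ; node-injective  = node-injective
    ; node-surjective = λ v → proj₁ (class v) , sym (singleton _ (proj₂ (class v)))
    ; edge            = λ i j _ → edge i j
    ; edge-source     = λ i j _ → edge-source i j
    ; edge-target     = λ i j _ → edge-target i j
    ; edge-injective  = λ { _ _ {0F} {0F} _ → refl }
    ; edge-surjective = edge-surjective
    }
    where
    0≁1 : node 0F ≁ node 1F
    0≁1 = apart λ ()
    0≁2 : node 0F ≁ node 2F
    0≁2 = apart λ ()
    1≁2 : node 1F ≁ node 2F
    1≁2 = apart λ ()

    cover : ∀ v → node 0F ∼ v ⊎ node 1F ∼ v ⊎ node 2F ∼ v
    cover v with node 0F ∼? v | node 1F ∼? v | node 2F ∼? v
    ... | yes 0∼v | _       | _       = inj₁ 0∼v
    ... | no  _   | yes 1∼v | _       = inj₂ (inj₁ 1∼v)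
    ... | no  _   | no  _   | yes 2∼v = inj₂ (inj₂ 2∼v)
    ... | no  0≁v | no  1≁v | no  2≁v = contradiction 1≁2 (no-four-classes 0≁v 1≁v 2≁v 0≁1 0≁2)

    class : ∀ v → ∃ λ i → node i ∼ v
    class v with cover v
    ... | inj₁ 0∼v        = 0F , 0∼v
    ... | inj₂ (inj₁ 1∼v) = 1F , 1∼v
    ... | inj₂ (inj₂ 2∼v) = 2F , 2∼v

    full = ThreeClasses.exists-full 0≁1 0≁2 1≁2 cover
    open WithFull (proj₁ (proj₂ full)) (proj₂ (proj₂ full))

    singleton : ∀ i {v} → node i ∼ v → v ≡ node i
    singleton 0F = Rotation.x-singleton 0≁1 0≁2 1≁2 cover ∼-refl
    -- The other two classes are handled by cyclically renaming the three.
    singleton 1F = Rotation.x-singleton 1≁2 (≁-sym 0≁1) (≁-sym 0≁2)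
      (λ v → [ (λ p → inj₂ (inj₂ p)) , [ inj₁ , (λ p → inj₂ (inj₁ p)) ]′ ]′ (cover v)) ∼-refl
    singleton 2F = Rotation.x-singleton (≁-sym 0≁2) (≁-sym 1≁2) 0≁1
      (λ v → [ (λ p → inj₂ (inj₁ p)) , [ (λ p → inj₂ (inj₂ p)) , inj₁ ]′ ]′ (cover v)) ∼-refl

    node-injective : Injective _≡_ _≡_ node
    node-injective {i} {j} eq with i Fin.≟ j
    ... | yes i≡j = i≡j
    ... | no  i≢j = contradiction (subst (node i ∼_) eq ∼-refl) (apart i≢j)

    η-target : ∀ {i j k} → k ≢ i → k ≢ j → i ≢ j → step (η (node k)) (node i) ≡ node j
    η-target {i} {j} k≢i k≢j i≢j =
      singleton j (η-crosses (apart k≢i) (apart λ j≡i → i≢j (sym j≡i)) (apart k≢j))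

    -- With singleton classes, `η` of the third node is the cycle of length two on `node i` and
    -- `node j`.
    edge : Fin 3 → Fin 3 → Edge
    edge i j with i Fin.≟ j
    ... | yes _ = ι (node i)
    ... | no  _ = η (node (proj₁ (third i j))) (node i)

    edge-source : ∀ i j → s (edge i j) ≡ node i
    edge-source i j with i Fin.≟ j
    ... | yes _ = s-ι (node i)
    ... | no  _ = Selection.source (η-selection (node (proj₁ (third i j)))) (node i)

    edge-target : ∀ i j → t (edge i j) ≡ node j
    edge-target i j with i Fin.≟ j
    ... | yes refl = t-ι (node i)
    ... | no  i≢j  = let _ , k≢i , k≢j = third i j in η-target k≢i k≢j i≢j

    chord : ∀ {e i j k} → e ≢ ι (s e) → s e ≡ node i → t e ≡ node j → k ≢ i → k ≢ j →
      η (node k) (node i) ≡ e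
    chord {e} {i} {j} {k} nonbase s≡ t≡ k≢i k≢j = trans (cong (η (node k)) (sym s≡))
      (η-chordless e nonbase (subst (node k ≁_) (sym s≡) (apart k≢i)) (subst (node k ≁_) (sym t≡) (apart k≢j)))

    edge≡ : ∀ {e} i j → s e ≡ node i → t e ≡ node j → edge i j ≡ e
    edge≡ {e} i j s≡ t≡ with i Fin.≟ j | e ≟ᴱ ι (s e)
    ... | yes _    | yes base = sym (trans base (cong ι s≡))
    ... | no  i≢j  | yes base = contradiction (node-injective (trans (sym s≡)
      (trans (sym (t-ι (s e))) (trans (cong t (sym base)) t≡)))) i≢j
    ... | no  i≢j  | no  nonbase = let _ , k≢i , k≢j = third i j in chord nonbase s≡ t≡ k≢i k≢j
    -- A second loop at `node i` would be taken by `η (node k)` through chordlessness, yet that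
    -- cycle leads from `node i` to `node l`.
    ... | yes refl | no  nonbase = contradiction (node-injective l≡i) l≢i
      where
      k = proj₁ (third i i)
      k≢i = proj₁ (proj₂ (third i i))
      l = proj₁ (third i k)
      l≢i = proj₁ (proj₂ (third i k))
      l≢k = proj₂ (proj₂ (third i k))
      l≡i : node l ≡ node i
      l≡i = trans (sym (η-target k≢i (λ k≡l → l≢k (sym k≡l)) (λ i≡l → l≢i (sym i≡l))))
        (trans (cong t (chord nonbase s≡ t≡ k≢i k≢i)) t≡)

    edge-surjective : ∀ e → ∃ λ i → ∃ λ j → ∃ λ (_ : Fin 1) → edge i j ≡ e
    edge-surjective e = let i , i∼ = class (s e) ; j , j∼ = class (t e) in
      i , j , 0F , edge≡ i j (singleton i i∼) (singleton j j∼)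

  -- The case of two classes.

  module TwoClasses {x y : Node} (x≁y : x ≁ y) (cover : ∀ v → x ∼ v ⊎ y ∼ v) where

    -- The union of the disjoint cycles `η y` and `η x`, which span the classes of `x` and of `y`: a
    -- selection without chosen loops that never crosses between the classes.
    both : Node → Edge
    both v with x ∼? v
    ... | yes _ = η y v
    ... | no  _ = η x v

    both-x : ∀ {v} → x ∼ v → both v ≡ η y v
    both-x {v} x∼v with x ∼? v
    ... | yes _   = refl
    ... | no  x≁v = contradiction x∼v x≁v

    both-y : ∀ {v} → y ∼ v → both v ≡ η x v
    both-y {v} y∼v with x ∼? v
    ... | yes x∼v = contradiction x∼v (outside x≁y y∼v)
    ... | no  _   = refl

    x-or-y : ∀ {v} → y ≁ v → x ∼ v
    x-or-y {v} y≁v with cover v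
    ... | inj₁ x∼v = x∼v
    ... | inj₂ y∼v = contradiction y∼v y≁v

    y-or-x : ∀ {v} → x ≁ v → y ∼ v
    y-or-x {v} x≁v with cover v
    ... | inj₁ x∼v = contradiction x∼v x≁v
    ... | inj₂ y∼v = y∼v

    both-nonbase : ∀ v → both v ≢ ι v
    both-nonbase v eq with cover v
    ... | inj₁ x∼v = outside (≁-sym x≁y) x∼v (trans (sym (both-x x∼v)) eq)
    ... | inj₂ y∼v = outside x≁y y∼v (trans (sym (both-y y∼v)) eq)

    step-x : ∀ {v} → x ∼ v → x ∼ step both v
    step-x {v} x∼v = subst (λ e → x ∼ t e) (sym (both-x x∼v)) (x-or-y (step-≁ (outside (≁-sym x≁y) x∼v)))

    step-y : ∀ {v} → y ∼ v → y ∼ step both v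
    step-y {v} y∼v = subst (λ e → y ∼ t e) (sym (both-y y∼v)) (y-or-x (step-≁ (outside x≁y y∼v)))

    both-source : ∀ v → s (both v) ≡ v
    both-source v with x ∼? v
    ... | yes _ = Selection.source (η-selection y) v
    ... | no  _ = Selection.source (η-selection x) v

    both-selection : Selection both
    both-selection = record { source = both-source ; injective = injective }
      where
      injective : Injective _≡_ _≡_ (step both)
      injective {u} {v} eq with cover u | cover v
      ... | inj₁ x∼u | inj₁ x∼v = Selection.injective (η-selection y)
        (trans (cong t (sym (both-x x∼u))) (trans eq (cong t (both-x x∼v))))
      ... | inj₂ y∼u | inj₂ y∼v = Selection.injective (η-selection x)
        (trans (cong t (sym (both-y y∼u))) (trans eq (cong t (both-y y∼v))))
      ... | inj₁ x∼u | inj₂ y∼v = contradiction (subst (x ∼_) eq (step-x x∼u)) (outside x≁y (step-y y∼v))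
      ... | inj₂ y∼u | inj₁ x∼v = contradiction (subst (y ∼_) eq (step-y y∼u)) (outside (≁-sym x≁y) (step-x x∼v))

    orbit-x : ∀ {v} → x ∼ v → ∀ i → x ∼ fold v (step (η y)) i
    orbit-x x∼v i = x-or-y (orbit-moved (η-selection y) (outside (≁-sym x≁y) x∼v) i)

    orbit-y : ∀ {v} → y ∼ v → ∀ i → y ∼ fold v (step (η x)) i
    orbit-y y∼v i = y-or-x (orbit-moved (η-selection x) (outside x≁y y∼v) i)

    -- A selection through `e` completes it to a directed cycle, which has to return to the class of
    -- `x`.
    edge-back : ∀ e → x ∼ s e → y ∼ t e → ∃ λ f → y ∼ s f × x ∼ t f
    edge-back e x∼s y∼t with p , _ , _ , (P , through) , _ ← two e = back (selection-periodic P (s e))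
      where
      back : Periodic (step p) (s e) → ∃ λ f → y ∼ s f × x ∼ t f
      back (j , period) = let i , y∼i , y≁1+i = crossing (y ∼?_) j y∼t y≁end in
        p (fold (t e) (step p) i) , subst (y ∼_) (sym (Selection.source P _)) y∼i , x-or-y y≁1+i
        where
        end : fold (t e) (step p) j ≡ s e
        end = trans (cong (λ v → fold v (step p) j) (cong t (sym through)))
          (trans (fold-commute (s e) (step p) 1 j) period)
        y≁end : y ≁ fold (t e) (step p) j
        y≁end eq = outside (≁-sym x≁y) x∼s (subst (y ∼_) end eq)

    -- With a second node v in the class of x, the edge chosen at v by η y would
    -- lie in η y, in both, and in a full cycle running through e and f.
    module _ {e f : Edge} (x∼se : x ∼ s e) (y∼te : y ∼ t e) (y∼sf : y ∼ s f) (x∼tf : x ∼ t f) where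

      private
        se≢sf : s e ≢ s f
        se≢sf eq = outside x≁y y∼sf (subst (x ∼_) eq x∼se)

        -- Its orbit from `t e` follows `η x` to `s f`, crosses by `f`, follows `η y` to `s e` and
        -- crosses back by `e`.
        detour : Node → Edge
        detour = (both [ s f ≔ f ]) [ s e ≔ e ]

        detour-source : ∀ v → s (detour v) ≡ v
        detour-source = ≔-source _ (≔-source both both-source refl) refl

        detour-e : detour (s e) ≡ e
        detour-e = ≔-at _ (s e) e

        detour-f : detour (s f) ≡ f
        detour-f = trans (≔-away _ e (λ eq → se≢sf (sym eq))) (≔-at both (s f) f)

        detour-x : ∀ {v} → x ∼ v → v ≢ s e → detour v ≡ η y v
        detour-x x∼v v≢ = trans (≔-away _ e v≢)
          (trans (≔-away both f (λ { refl → outside x≁y y∼sf x∼v })) (both-x x∼v))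

        detour-y : ∀ {v} → y ∼ v → v ≢ s f → detour v ≡ η x v
        detour-y y∼v v≢ = trans (≔-away _ e (λ { refl → outside x≁y y∼v x∼se }))
          (trans (≔-away both f v≢) (both-y y∼v))

        detour-nonbase : ∀ v → detour v ≢ ι v
        detour-nonbase v with v ≟ᴺ s e | v ≟ᴺ s f | cover v
        ... | yes refl | _        | _        = λ eq → outside x≁y y∼te
          (subst (x ∼_) (sym (trans (cong t (trans (sym detour-e) eq)) (t-ι (s e)))) x∼se)
        ... | no _     | yes refl | _        = λ eq → outside (≁-sym x≁y) x∼tf
          (subst (y ∼_) (sym (trans (cong t (trans (sym detour-f) eq)) (t-ι (s f)))) y∼sf)
        ... | no v≢    | no _     | inj₁ x∼v = λ eq → outside (≁-sym x≁y) x∼v (trans (sym (detour-x x∼v v≢)) eq)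
        ... | no _     | no v≢    | inj₂ y∼v = λ eq → outside x≁y y∼v (trans (sym (detour-y y∼v v≢)) eq)

        to-f : ∃[ i ] fold (t e) (step detour) i ≡ s f
        to-f = reroute _≟ᴺ_ {step (η x)} {step detour}
          (λ i ≢sf → cong t (detour-y (orbit-y y∼te i) ≢sf)) (proj₁ path) (proj₂ path)
          where
          path : ∃[ i ] fold (t e) (step (η x)) i ≡ s f
          path = η-transitive (outside x≁y y∼te) (outside x≁y y∼sf)

        to-e : ∃[ i ] fold (t f) (step detour) i ≡ s e
        to-e = reroute _≟ᴺ_ {step (η y)} {step detour}
          (λ i ≢se → cong t (detour-x (orbit-x x∼tf i) ≢se)) (proj₁ path) (proj₂ path)
          where
          path : ∃[ i ] fold (t f) (step (η y)) i ≡ s e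
          path = η-transitive (outside (≁-sym x≁y) x∼tf) (outside (≁-sym x≁y) x∼se)

        at-f : fold (t e) (step detour) (suc (proj₁ to-f)) ≡ t f
        at-f = trans (cong (step detour) (proj₂ to-f)) (cong t detour-f)

        period : Periodic (step detour) (t e)
        period = proj₁ to-e + suc (proj₁ to-f) , (begin
          fold (t e) (step detour) (suc (proj₁ to-e + suc (proj₁ to-f)))
            ≡⟨ fold-+ (t e) (step detour) (suc (proj₁ to-e)) ⟩
          fold (fold (t e) (step detour) (suc (proj₁ to-f))) (step detour) (suc (proj₁ to-e))
            ≡⟨ cong (λ v → fold v (step detour) (suc (proj₁ to-e))) at-f ⟩
          step detour (fold (t f) (step detour) (proj₁ to-e))
            ≡⟨ cong (step detour) (proj₂ to-e) ⟩
          step detour (s e)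
            ≡⟨ cong t detour-e ⟩
          t e ∎)
          where open ≡-Reasoning

        module _ (c : CycleOf detour (t e)) where
          open CycleOf c

          moved : ∀ i {v} → fold (t e) (step detour) i ≡ v → cycle v ≢ ι v
          moved i refl eq = detour-nonbase _ (trans (sym (on i)) eq)

          -- The cycle moves `t e` and `t f`, which lie in different classes, while every `η d`
          -- takes the loops of a whole class.
          full-cycle : Full cycle
          full-cycle with full? selection (moved 0 refl)
          ... | inj₁ full = full
          ... | inj₂ (d , same) with cover d
          ...   | inj₁ x∼d = contradiction
            (trans (sym (same (t f))) (∼-trans (∼-sym x∼d) x∼tf)) (moved (suc (proj₁ to-f)) at-f)
          ...   | inj₂ y∼d = contradiction
            (trans (sym (same (t e))) (∼-trans (∼-sym y∼d) y∼te)) (moved 0 refl)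

          cycle≗detour : cycle ≗ detour
          cycle≗detour v with on-or-off v
          ... | inj₁ eq = eq
          ... | inj₂ eq = contradiction eq (full-cycle v)

          detour-singleton : ∀ {v} → x ∼ v → v ≡ s e
          detour-singleton {v} x∼v with v ≟ᴺ s e
          ... | yes eq = eq
          ... | no  v≢ with three-through v (η-selection y) both-selection selection
                              (both-x x∼v) (trans (cycle≗detour v) (detour-x x∼v v≢))
          ...   | inj₁ eq        = contradiction (trans (sym (eq y)) ∼-refl) (both-nonbase y)
          ...   | inj₂ (inj₁ eq) = contradiction (trans (sym (eq y)) ∼-refl) (full-cycle y)
          -- At `s e` the selection `both` stays in the class of `x`, whereas the cycle leaves it by
          -- `e`.
          ...   | inj₂ (inj₂ eq) = contradiction (subst (x ∼_) ends (step-x x∼se)) (outside x≁y y∼te)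
            where
            ends : step both (s e) ≡ t e
            ends = cong t (trans (eq (s e)) (trans (cycle≗detour (s e)) detour-e))

      crossing-singleton : ∀ {v} → x ∼ v → v ≡ s e
      crossing-singleton = detour-singleton (cycleOf detour-source period)

  -- Digraphs on two nodes.

  module TwoNodes (node : Fin 2 → Node) (node-injective : Injective _≡_ _≡_ node)
    (node-surjective : ∀ v → ∃ λ i → node i ≡ v) where

    opposite-≢ : (i : Fin 2) → i ≢ opposite i
    opposite-≢ 0F ()
    opposite-≢ 1F ()

    ≢⇒opposite : (i j : Fin 2) → i ≢ j → i ≡ opposite j
    ≢⇒opposite 0F 0F i≢j = contradiction refl i≢j
    ≢⇒opposite 0F 1F i≢j = refl
    ≢⇒opposite 1F 0F i≢j = refl
    ≢⇒opposite 1F 1F i≢j = contradiction refl i≢j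

    Between : Fin 2 → Fin 2 → Edge → Set
    Between i j e = s e ≡ node i × t e ≡ node j

    -- A selection permutes the two nodes, so at the node other than `s r` its edge ends at the node
    -- other than `t r`.
    opposite-edge : ∀ i j {r} → Between (opposite i) (opposite j) r →
      ∀ {p} → Through r p → Between i j (p (node i))
    opposite-edge i j {r} (sr , tr) {p} (P , through) = Selection.source P (node i) , target
      where
      target : t (p (node i)) ≡ node j
      target with k , hit ← node-surjective (t (p (node i))) | k Fin.≟ j
      ... | yes refl = sym hit
      ... | no  k≢j  = contradiction
        (node-injective (Selection.injective P (trans (sym hit) (trans (cong node (≢⇒opposite k j k≢j))
          (trans (sym tr) (cong t (trans (sym through) (cong p sr))))))))
        (opposite-≢ i)

    -- On two nodes a selection through r amounts to an edge opposite to r.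
    opposite-selection : ∀ i j {e r} → Between i j e → Between (opposite i) (opposite j) r →
      Through r ((λ _ → r) [ s e ≔ e ])
    opposite-selection i j {e} {r} (se , te) (sr , tr) =
      record { source = source ; injective = injective } , ≔-away _ e sr≢se
      where
      sr≢se : s r ≢ s e
      sr≢se eq = opposite-≢ i (node-injective (trans (sym se) (trans (sym eq) sr)))
      te≢tr : t e ≢ t r
      te≢tr eq = opposite-≢ j (node-injective (trans (sym te) (trans eq tr)))
      other : ∀ {v} → v ≢ s e → v ≡ s r
      other {v} v≢ with k , refl ← node-surjective v =
        trans (cong node (≢⇒opposite k i λ { refl → v≢ (sym se) })) (sym sr)
      source : ∀ v → s (((λ _ → r) [ s e ≔ e ]) v) ≡ v
      source v with v ≟ᴺ s e
      ... | yes refl = cong s (≔-at _ (s e) e)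
      ... | no  v≢   = trans (cong s (≔-away _ e v≢)) (sym (other v≢))
      injective : Injective _≡_ _≡_ (step ((λ _ → r) [ s e ≔ e ]))
      injective {u} {v} eq with u ≟ᴺ s e | v ≟ᴺ s e
      ... | yes u≡ | yes v≡ = trans u≡ (sym v≡)
      ... | no  u≢ | no  v≢ = trans (other u≢) (sym (other v≢))
      ... | yes refl | no v≢ = contradiction
        (trans (cong t (sym (≔-at _ (s e) e))) (trans eq (cong t (≔-away _ e v≢)))) te≢tr
      ... | no u≢ | yes refl = contradiction
        (trans (cong t (sym (≔-at _ (s e) e))) (trans (sym eq) (cong t (≔-away _ e u≢)))) te≢tr

    -- The edges from `node i` to `node j` correspond to the selections through any fixed edge
    -- between the opposite nodes; there are exactly two of these.
    two-nodes⇒Table : (∀ i j → ∃ (Between i j)) → Table 2 2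
    two-nodes⇒Table rep = record
      { node            = node
      ; node-injective  = node-injective
      ; node-surjective = node-surjective
      ; edge            = λ i j k → selection i j k (node i)
      ; edge-source     = λ i j k → proj₁ (between i j k)
      ; edge-target     = λ i j k → proj₂ (between i j k)
      ; edge-injective  = λ i j {k} {l} → edge-injective i j k l
      ; edge-surjective = edge-surjective
      }
      where
      r : Fin 2 → Fin 2 → Edge
      r i j = proj₁ (rep (opposite i) (opposite j))

      r-between : ∀ i j → Between (opposite i) (opposite j) (r i j)
      r-between i j = proj₂ (rep (opposite i) (opposite j))

      selection : Fin 2 → Fin 2 → Fin 2 → Node → Edge
      selection i j 0F = proj₁ (two (r i j))
      selection i j 1F = proj₁ (proj₂ (two (r i j)))

      through : ∀ i j k → Through (r i j) (selection i j k)
      through i j 0F = proj₁ (proj₂ (proj₂ (proj₂ (two (r i j)))))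
      through i j 1F = proj₁ (proj₂ (proj₂ (proj₂ (proj₂ (two (r i j))))))

      between : ∀ i j k → Between i j (selection i j k (node i))
      between i j k = opposite-edge i j (r-between i j) (through i j k)

      -- Both selections take `r i j` at the other node, so they can differ only at `node i`.
      agree : ∀ i j → selection i j 0F (node i) ≢ selection i j 1F (node i)
      agree i j eq = proj₁ (proj₂ (proj₂ (two (r i j)))) same
        where
        same : selection i j 0F ≗ selection i j 1F
        same v with k , refl ← node-surjective v | k Fin.≟ i
        ... | yes refl = eq
        ... | no  k≢i  = subst (λ u → selection i j 0F u ≡ selection i j 1F u)
          (trans (proj₁ (r-between i j)) (cong node (sym (≢⇒opposite k i k≢i))))
          (trans (proj₂ (through i j 0F)) (sym (proj₂ (through i j 1F))))

      edge-injective : ∀ i j k l → selection i j k (node i) ≡ selection i j l (node i) → k ≡ l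
      edge-injective i j 0F 0F eq = refl
      edge-injective i j 0F 1F eq = contradiction eq (agree i j)
      edge-injective i j 1F 0F eq = contradiction (sym eq) (agree i j)
      edge-injective i j 1F 1F eq = refl

      edge-surjective : ∀ e → ∃ λ i → ∃ λ j → ∃ λ k → selection i j k (node i) ≡ e
      edge-surjective e = i , j , found (proj₂ (proj₂ (proj₂ (proj₂ (proj₂ (two (r i j)))))) p-through)
        where
        i = proj₁ (node-surjective (s e))
        j = proj₁ (node-surjective (t e))
        se : s e ≡ node i
        se = sym (proj₂ (node-surjective (s e)))
        p : Node → Edge
        p = (λ _ → r i j) [ s e ≔ e ]
        p-through : Through (r i j) p
        p-through = opposite-selection i j (se , sym (proj₂ (node-surjective (t e)))) (r-between i j)
        p-e : p (node i) ≡ e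
        p-e = trans (cong p (sym se)) (≔-at _ (s e) e)
        found : p ≗ selection i j 0F ⊎ p ≗ selection i j 1F → ∃ λ k → selection i j k (node i) ≡ e
        found (inj₁ eq) = 0F , trans (sym (eq (node i))) p-e
        found (inj₂ eq) = 1F , trans (sym (eq (node i))) p-e

  two-classes⇒Table : ∀ {x y} → x ≁ y → (∀ v → x ∼ v ⊎ y ∼ v) →
    ∀ e → x ∼ s e → y ∼ t e → Table 2 2
  two-classes⇒Table {x} {y} x≁y cover e x∼se y∼te =
    TwoNodes.two-nodes⇒Table node node-injective node-surjective rep
    where
    back : ∃ λ f → y ∼ s f × x ∼ t f
    back = TwoClasses.edge-back x≁y cover e x∼se y∼te
    f : Edge
    f = proj₁ back
    y∼sf : y ∼ s f
    y∼sf = proj₁ (proj₂ back)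
    x∼tf : x ∼ t f
    x∼tf = proj₂ (proj₂ back)

    node : Fin 2 → Node
    node 0F = s e
    node 1F = s f

    x-singleton : ∀ {v} → x ∼ v → v ≡ s e
    x-singleton = TwoClasses.crossing-singleton x≁y cover x∼se y∼te y∼sf x∼tf

    y-singleton : ∀ {v} → y ∼ v → v ≡ s f
    y-singleton = TwoClasses.crossing-singleton (≁-sym x≁y)
      (λ v → [ inj₂ , inj₁ ]′ (cover v)) y∼sf x∼tf x∼se y∼te

    se≢sf : s e ≢ s f
    se≢sf eq = outside x≁y y∼sf (subst (x ∼_) eq x∼se)

    node-injective : Injective _≡_ _≡_ node
    node-injective {0F} {0F} _  = refl
    node-injective {0F} {1F} eq = contradiction eq se≢sf
    node-injective {1F} {0F} eq = contradiction (sym eq) se≢sf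
    node-injective {1F} {1F} _  = refl

    node-surjective : ∀ v → ∃ λ i → node i ≡ v
    node-surjective v with cover v
    ... | inj₁ x∼v = 0F , sym (x-singleton x∼v)
    ... | inj₂ y∼v = 1F , sym (y-singleton y∼v)

    rep : ∀ i j → ∃ λ g → s g ≡ node i × t g ≡ node j
    rep 0F 0F = ι (s e) , s-ι (s e) , t-ι (s e)
    rep 0F 1F = e , refl , y-singleton y∼te
    rep 1F 0F = f , refl , x-singleton x∼tf
    rep 1F 1F = ι (s f) , s-ι (s f) , t-ι (s f)

  -- `η x` moves some `y`, so there are at least two classes. If there is no third, connectedness
  -- supplies an edge between the two; its direction decides which class plays the part of `x`.
  connected⇒Table : Node → (∀ u v → Star (λ a b → ∃ λ e → Joins e a b) u v) → Table 3 1 ⊎ Table 2 2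
  connected⇒Table x connected with y , x≁y ← η-moves x
    with search (λ z → ¬? (x ∼? z) ×-dec ¬? (y ∼? z))
  ... | yes (z , x≁z , y≁z) = inj₁ (three-classes⇒Table node apart)
    where
    node : Fin 3 → Node
    node 0F = x
    node 1F = y
    node 2F = z
    apart : ∀ {i j} → i ≢ j → node i ≁ node j
    apart {0F} {0F} i≢j = contradiction refl i≢j
    apart {0F} {1F} _   = x≁y
    apart {0F} {2F} _   = x≁z
    apart {1F} {0F} _   = ≁-sym x≁y
    apart {1F} {1F} i≢j = contradiction refl i≢j
    apart {1F} {2F} _   = y≁z
    apart {2F} {0F} _   = ≁-sym x≁z
    apart {2F} {1F} _   = ≁-sym y≁z
    apart {2F} {2F} i≢j = contradiction refl i≢j
  ... | no none = inj₂ (conclude (crossing-edge (x ∼?_) (connected x y) ∼-refl x≁y))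
    where
    cover : ∀ v → x ∼ v ⊎ y ∼ v
    cover v with x ∼? v | y ∼? v
    ... | yes x∼v | _       = inj₁ x∼v
    ... | no  _   | yes y∼v = inj₂ y∼v
    ... | no  x≁v | no  y≁v = contradiction (v , x≁v , y≁v) none
    in-y : ∀ {v} → x ≁ v → y ∼ v
    in-y = TwoClasses.y-or-x x≁y cover
    conclude : (∃ λ e → (x ∼ s e × x ≁ t e) ⊎ (x ≁ s e × x ∼ t e)) → Table 2 2
    conclude (e , inj₁ (x∼s , x≁t)) = two-classes⇒Table x≁y cover e x∼s (in-y x≁t)
    conclude (e , inj₂ (x≁s , x∼t)) =
      two-classes⇒Table (≁-sym x≁y) (λ v → [ inj₂ , inj₁ ]′ (cover v)) e (in-y x≁s) x∼t

subset-ext : ∀ {n} {P Q : Subset n} → (∀ {e} → e ∈ P → e ∈ Q) → (∀ {e} → e ∈ Q → e ∈ P) → P ≡ Q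
subset-ext P⊆Q Q⊆P = ⊆-antisym P⊆Q Q⊆P

-- Contracting a perfect matching of a bipartite graph.

module BipartiteMatching (G : Graph) (side : Graph.Vertex G → Bool)
  (proper : ∀ e → side (proj₁ (Graph.ends G e)) ≢ side (proj₂ (Graph.ends G e)))
  {M} (matching : Graph.PerfectMatching G M) where

  open Graph G

  -- Each matching edge has exactly one end on the side `true`, and that end stands for the
  -- contracted edge.
  Node : Set
  Node = ∃ λ v → side v ≡ true

  node≡ : ∀ {a b : Node} → proj₁ a ≡ proj₁ b → a ≡ b
  node≡ {_ , p} {_ , q} refl = cong (_ ,_) (Decidable⇒UIP.≡-irrelevant Bool._≟_ p q)

  _≟ᴺ_ : DecidableEquality Node
  a ≟ᴺ b = map′ node≡ (cong proj₁) (proj₁ a Fin.≟ proj₁ b)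

  search : ∀ {P : Node → Set} → Decidable P → Dec (∃ P)
  search {P} P? = map′ (λ { (v , p , Pv) → (v , p) , Pv }) (λ { ((v , p) , Pv) → v , p , Pv })
    (Fin.any? at?)
    where
    at? : ∀ v → Dec (∃ λ p → P (v , p))
    at? v with side v Bool.≟ true
    ... | no  ≢true = no λ { (p , _) → ≢true p }
    ... | yes p     = map′ (p ,_) (λ { (q , Pq) → subst P (node≡ refl) Pq }) (P? (v , p))

  Oriented : Vertex × Vertex → Set
  Oriented uv = ∃₂ λ a b → side a ≡ true × side b ≡ false × (uv ≡ (a , b) ⊎ uv ≡ (b , a))

  orient : ∀ u v → side u ≢ side v → Oriented (u , v)
  orient u v u≢v with side u in p | side v in q
  ... | true  | true  = contradiction refl u≢v
  ... | true  | false = u , v , p , q , inj₁ refl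
  ... | false | true  = v , u , q , p , inj₂ refl
  ... | false | false = contradiction refl u≢v

  oriented : ∀ e → Oriented (ends e)
  oriented e = orient (proj₁ (ends e)) (proj₂ (ends e)) (proper e)

  abstract
    s : Edge → Node
    s e = let a , _ , p , _ = oriented e in a , p

    end : Edge → Vertex
    end e = proj₁ (proj₂ (oriented e))

    end-false : ∀ e → side (end e) ≡ false
    end-false e = proj₁ (proj₂ (proj₂ (proj₂ (oriented e))))

    ends≡ : ∀ e → ends e ≡ (proj₁ (s e) , end e) ⊎ ends e ≡ (end e , proj₁ (s e))
    ends≡ e = proj₂ (proj₂ (proj₂ (proj₂ (oriented e))))

  incident-s : ∀ e → Incident (proj₁ (s e)) e
  incident-s e with ends≡ e
  ... | inj₁ eq = inj₁ (sym (cong proj₁ eq))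
  ... | inj₂ eq = inj₂ (sym (cong proj₂ eq))

  incident-end : ∀ e → Incident (end e) e
  incident-end e with ends≡ e
  ... | inj₁ eq = inj₂ (sym (cong proj₂ eq))
  ... | inj₂ eq = inj₁ (sym (cong proj₁ eq))

  incident⇒ : ∀ {v} e → Incident v e → v ≡ proj₁ (s e) ⊎ v ≡ end e
  incident⇒ e inc with ends≡ e | inc
  ... | inj₁ eq | inj₁ v≡ = inj₁ (trans v≡ (cong proj₁ eq))
  ... | inj₁ eq | inj₂ v≡ = inj₂ (trans v≡ (cong proj₂ eq))
  ... | inj₂ eq | inj₁ v≡ = inj₂ (trans v≡ (cong proj₁ eq))
  ... | inj₂ eq | inj₂ v≡ = inj₁ (trans v≡ (cong proj₂ eq))

  s≡ : ∀ {a : Node} {e} → Incident (proj₁ a) e → s e ≡ a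
  s≡ {_ , p} {e} inc with incident⇒ e inc
  ... | inj₁ a≡ = node≡ (sym a≡)
  ... | inj₂ refl = contradiction (trans (sym p) (end-false e)) λ ()

  end≡ : ∀ {v e} → side v ≡ false → Incident v e → end e ≡ v
  end≡ {e = e} q inc with incident⇒ e inc
  ... | inj₁ refl = contradiction (trans (sym (proj₂ (s e))) q) λ ()
  ... | inj₂ v≡   = sym v≡

  module Matched {P} (pm : PerfectMatching P) where

    matched : Vertex → Edge
    matched v = proj₁ (pm v)

    matched-∈ : ∀ v → matched v ∈ P
    matched-∈ v = proj₁ (proj₁ (proj₂ (pm v)))

    matched-incident : ∀ v → Incident v (matched v)
    matched-incident v = proj₂ (proj₁ (proj₂ (pm v)))

    matched-unique : ∀ {v e} → e ∈ P → Incident v e → matched v ≡ e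
    matched-unique {v} e∈ inc = proj₂ (proj₂ (pm v)) (e∈ , inc)

    select : Node → Edge
    select a = matched (proj₁ a)

    select-source : ∀ a → s (select a) ≡ a
    select-source a = s≡ (matched-incident (proj₁ a))

    select-∈ : ∀ {e} → e ∈ P → select (s e) ≡ e
    select-∈ {e} e∈ = matched-unique e∈ (incident-s e)

    ∈-select : ∀ {e} → select (s e) ≡ e → e ∈ P
    ∈-select {e} eq = subst (_∈ P) eq (matched-∈ (proj₁ (s e)))

  open Matched matching public using ()
    renaming (matched to partner; matched-∈ to partner-∈; matched-incident to partner-incident;
              matched-unique to partner-unique; select to ι; select-source to s-ι)

  -- The contraction map. An edge of the graph is directed from its end on the side `true` to the
  -- node containing its other end.
  home : Vertex → Node
  home v = s (partner v)

  t : Edge → Node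
  t e = home (end e)

  home-node : ∀ a → home (proj₁ a) ≡ a
  home-node = s-ι

  t-ι : ∀ a → t (ι a) ≡ a
  t-ι a = trans (cong s (partner-unique (partner-∈ (proj₁ a)) (incident-end (ι a)))) (s-ι a)

  home-end-ι : ∀ {v} → side v ≡ false → end (ι (home v)) ≡ v
  home-end-ι {v} q = trans (cong end (partner-unique (partner-∈ v) (incident-s (partner v))))
    (end≡ q (partner-incident v))

  home-injective : ∀ {u v} → side u ≡ false → side v ≡ false → home u ≡ home v → u ≡ v
  home-injective p q eq = trans (sym (home-end-ι p)) (trans (cong (λ a → end (ι a)) eq) (home-end-ι q))

  end-t : ∀ e → end (ι (t e)) ≡ end e
  end-t e = home-end-ι (end-false e)

  open Selections s t

  abstract
    edgeSet : (Node → Edge) → Subset size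
    edgeSet p = tabulate λ e → does (p (s e) Fin.≟ e)

    ∈-edgeSet : ∀ {p e} → p (s e) ≡ e → e ∈ edgeSet p
    ∈-edgeSet {p} {e} eq = lookup⇒[]= e (edgeSet p) (trans (lookup∘tabulate _ e) (dec-true (p (s e) Fin.≟ e) eq))

    edgeSet-∈ : ∀ {p e} → e ∈ edgeSet p → p (s e) ≡ e
    edgeSet-∈ {p} {e} e∈ with p (s e) Fin.≟ e
      | trans (sym (lookup∘tabulate (λ e → does (p (s e) Fin.≟ e)) e)) ([]=⇒lookup e∈)
    ... | yes eq | _  = eq
    ... | no  _  | ()

    edgeSet-cong : ∀ {p q} → p ≗ q → edgeSet p ≡ edgeSet q
    edgeSet-cong p≗q = tabulate-cong λ e → cong (λ f → does (f Fin.≟ e)) (p≗q (s e))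

  selection⇒matching : ∀ {p} → Selection p → PerfectMatching (edgeSet p)
  selection⇒matching {p} P v with side v in eq
  ... | true  = p a ,
    (∈-edgeSet (cong p (source a)) , subst (λ b → Incident (proj₁ b) (p a)) (source a) (incident-s (p a))) ,
    λ { (y∈ , inc) → trans (cong p (sym (s≡ inc))) (edgeSet-∈ y∈) }
    where
    open Selection P
    a : Node
    a = v , eq
  ... | false = p a ,
    (∈-edgeSet (cong p (source a)) , subst (λ u → Incident u (p a)) end≡v (incident-end (p a))) ,
    λ {y} yinc → let y∈ , inc = yinc; py = edgeSet-∈ y∈ in
      trans (cong p (injective (trans a-home (trans (cong home (sym (end≡ eq inc))) (cong t (sym py)))))) py
    where
    open Selection P
    -- The last node before the orbit returns to `home v` is a preimage of `home v`; the edge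
    -- selected there covers `v`.
    period : Periodic (step p) (home v)
    period = injective⇒periodic {index = proj₁} node≡ injective (home v)
    a : Node
    a = fold (home v) (step p) (proj₁ period)
    a-home : step p a ≡ home v
    a-home = proj₂ period
    end≡v : end (p a) ≡ v
    end≡v = home-injective (end-false (p a)) eq a-home

  module _ {P} (pm : PerfectMatching P) where
    open Matched pm

    -- Two selected edges with the same target share their end on the side `false`, where the
    -- matching has only one edge.
    matching⇒selection : Selection select
    matching⇒selection = record
      { source    = select-source
      ; injective = λ {a} {b} eq → trans (sym (select-source a)) (trans (cong s (same a b eq)) (select-source b))
      }
      where
      same : ∀ a b → t (select a) ≡ t (select b) → select a ≡ select b
      same a b eq = trans (sym (matched-unique (matched-∈ _) (incident-end (select a))))
        (matched-unique (matched-∈ _) (subst (λ v → Incident v (select b))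
          (sym (home-injective (end-false _) (end-false _) eq)) (incident-end (select b))))

    edgeSet-select : edgeSet select ≡ P
    edgeSet-select = subset-ext (λ e∈ → ∈-select (edgeSet-∈ e∈)) (λ e∈ → ∈-edgeSet (select-∈ e∈))

    edgeSet≡⇒≗ : ∀ {p} → Selection p → edgeSet p ≡ P → p ≗ select
    edgeSet≡⇒≗ {p} S eq a = sym (trans (cong select (sym (Selection.source S a)))
      (select-∈ (subst (p a ∈_) eq (∈-edgeSet (cong p (Selection.source S a))))))

  exactly-two : ∀ {e} → InExactlyTwoPerfectMatchings e → InExactlyTwo e
  exactly-two {e} (A , B , A≢B , (a , e∈A) , (b , e∈B) , only) =
    Matched.select a , Matched.select b ,
    (λ a≗b → A≢B (trans (sym (edgeSet-select a)) (trans (edgeSet-cong a≗b) (edgeSet-select b)))) ,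
    (matching⇒selection a , Matched.select-∈ a e∈A) ,
    (matching⇒selection b , Matched.select-∈ b e∈B) ,
    λ {p} through → choose through (only (edgeSet p) (selection⇒matching (proj₁ through) , ∈-edgeSet (proj₂ through)))
    where
    choose : ∀ {p} → Through e p → edgeSet p ≡ A ⊎ edgeSet p ≡ B → p ≗ Matched.select a ⊎ p ≗ Matched.select b
    choose (S , _) (inj₁ eq) = inj₁ (edgeSet≡⇒≗ a S eq)
    choose (S , _) (inj₂ eq) = inj₂ (edgeSet≡⇒≗ b S eq)

  home-joins : ∀ {u v} → Adjacent u v → ∃ λ e → Joins e (home u) (home v)
  home-joins (e , adj) = e , join adj
    where
    home-s : home (proj₁ (s e)) ≡ s e
    home-s = home-node (s e)
    join : ∀ {u v} → ends e ≡ (u , v) ⊎ ends e ≡ (v , u) → Joins e (home u) (home v)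
    join (inj₁ uv) with ends≡ e
    ... | inj₁ eq with refl ← trans (sym uv) eq = inj₁ (sym home-s , refl)
    ... | inj₂ eq with refl ← trans (sym uv) eq = inj₂ (sym home-s , refl)
    join (inj₂ vu) with ends≡ e
    ... | inj₁ eq with refl ← trans (sym vu) eq = inj₂ (sym home-s , refl)
    ... | inj₂ eq with refl ← trans (sym vu) eq = inj₁ (sym home-s , refl)

  home-connected : Connected → ∀ a b → Star (λ u v → ∃ λ e → Joins e u v) a b
  home-connected connected a b = subst₂ (Star _) (home-node a) (home-node b)
    (gmap home home-joins (connected (proj₁ a) (proj₁ b)))

-- Checking the two graphs by exhaustive search.

allSubset? : ∀ {n} {P : Subset n → Set} → Decidable P → Dec (∀ Q → P Q)
allSubset? P? = map′ (λ none Q → decidable-stable (P? Q) λ ¬P → none (Q , ¬P)) (λ all (Q , ¬P) → ¬P (all Q))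
  (¬? (anySubset? λ Q → ¬? (P? Q)))

module _ (G : Graph) where
  open Graph G

  incident? : ∀ v e → Dec (Incident v e)
  incident? v e = (v Fin.≟ proj₁ (ends e)) ⊎-dec (v Fin.≟ proj₂ (ends e))

  perfectMatching? : Decidable PerfectMatching
  perfectMatching? M = Fin.all? λ v → Fin.any? λ e →
    ((e ∈? M) ×-dec incident? v e) ×-dec
    map′ (λ all {y} → all y) (λ all y → all {y})
      (Fin.all? λ y → ((y ∈? M) ×-dec incident? v y) →-dec (e Fin.≟ y))

  through? : ∀ e → Decidable (PerfectMatchingThrough e)
  through? e M = perfectMatching? M ×-dec (e ∈? M)

  _≟ˢ_ : (M N : Subset size) → Dec (M ≡ N)
  _≟ˢ_ = ≡-dec Bool._≟_

  -- The two matchings are arguments, so that only `P` is searched for.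
  exactlyTwo? : ∀ e M N → Dec (M ≢ N × PerfectMatchingThrough e M × PerfectMatchingThrough e N ×
    (∀ P → PerfectMatchingThrough e P → P ≡ M ⊎ P ≡ N))
  exactlyTwo? e M N = ¬? (M ≟ˢ N) ×-dec through? e M ×-dec through? e N ×-dec
    allSubset? λ P → through? e P →-dec ((P ≟ˢ M) ⊎-dec (P ≟ˢ N))

  adjacent? : ∀ u v → Dec (Adjacent u v)
  adjacent? u v = Fin.any? λ e → (ends e ≟ (u , v)) ⊎-dec (ends e ≟ (v , u))
    where _≟_ = Product.≡-dec Fin._≟_ Fin._≟_

  -- A decidable condition that suffices for connectedness and holds in both graphs; a vertex
  -- reaches itself through a neighbour.
  AtDistanceAtMostTwo : Vertex → Vertex → Set
  AtDistanceAtMostTwo u v = Adjacent u v ⊎ ∃ λ w → Adjacent u w × Adjacent w v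

  atDistanceAtMostTwo? : ∀ u v → Dec (AtDistanceAtMostTwo u v)
  atDistanceAtMostTwo? u v = adjacent? u v ⊎-dec Fin.any? λ w → adjacent? u w ×-dec adjacent? w v

  diameter≤2⇒connected : (∀ u v → AtDistanceAtMostTwo u v) → Connected
  diameter≤2⇒connected near u v with near u v
  ... | inj₁ uv            = uv ◅ ε
  ... | inj₂ (w , uw , wv) = uw ◅ wv ◅ ε

K₃,₃-connected : Graph.Connected K₃,₃
K₃,₃-connected = diameter≤2⇒connected K₃,₃
  (from-yes (Fin.all? {6} λ u → Fin.all? {6} λ v → atDistanceAtMostTwo? K₃,₃ u v))

-- The two permutations of Z/3 through (i , j) are the one with constant sum
-- and the one with constant difference, a + 2b being a − b modulo 3.
K₃,₃-exactlyTwo : ∀ e → Graph.InExactlyTwoPerfectMatchings K₃,₃ e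
K₃,₃-exactlyTwo e = _ , _ , from-yes (Fin.all? {9} λ e →
  exactlyTwo? K₃,₃ e (level (λ a b → a + b) e) (level (λ a b → a + (b + b)) e)) e
  where
  level : (ℕ → ℕ → ℕ) → Fin 9 → Subset 9
  level f e = tabulate λ e′ → does (value e′ ℕ.≟ value e)
    where
    value : Fin 9 → ℕ
    value e = let i , j = remQuot {3} 3 e in f (toℕ i) (toℕ j) % 3

C₄⁴-connected : Graph.Connected C₄⁴
C₄⁴-connected = diameter≤2⇒connected C₄⁴
  (from-yes (Fin.all? {4} λ u → Fin.all? {4} λ v → atDistanceAtMostTwo? C₄⁴ u v))

-- A perfect matching consists of one copy each of two opposite edges of the 4-cycle. `facing e`
-- lists the two copies opposite to `e`.
C₄⁴-exactlyTwo : ∀ e → Graph.InExactlyTwoPerfectMatchings C₄⁴ e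
C₄⁴-exactlyTwo e = _ , _ , from-yes (Fin.all? {8} λ e →
  exactlyTwo? C₄⁴ e (⁅ e ⁆ ∪ ⁅ facing e 0F ⁆) (⁅ e ⁆ ∪ ⁅ facing e 1F ⁆)) e
  where
  facing : Fin 8 → Fin 2 → Fin 8
  facing e k = combine {4} {2} (across (quotient {4} 2 e)) k
    where
    across : Fin 4 → Fin 4
    across 0F = 2F
    across 1F = 3F
    across 2F = 0F
    across 3F = 1F

-- Invariance under isomorphism.

≅-sym : ∀ {G H} → G ≅ H → H ≅ G
≅-sym {G} {H} φ = record
  { vertices      = ↔-sym vertices
  ; edges         = ↔-sym edges
  ; preservesEnds = λ f → back f (preservesEnds (E.from f))
  }
  where
  module G = Graph G
  module H = Graph H
  open _≅_ φ
  module V = Inverse vertices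
  module E = Inverse edges

  unmap : ∀ uv → map V.from V.from (map V.to V.to uv) ≡ uv
  unmap (u , v) = cong₂ _,_ (V.strictlyInverseʳ u) (V.strictlyInverseʳ v)

  back : ∀ f → let uv = map V.to V.to (G.ends (E.from f)) in
    H.ends (E.to (E.from f)) ≡ uv ⊎ H.ends (E.to (E.from f)) ≡ swap uv →
    let uv = map V.from V.from (H.ends f) in G.ends (E.from f) ≡ uv ⊎ G.ends (E.from f) ≡ swap uv
  back f same rewrite E.strictlyInverseˡ f with same
  ... | inj₁ eq = inj₁ (sym (trans (cong (map V.from V.from) eq) (unmap _)))
  ... | inj₂ eq = inj₂ (sym (trans (cong (swap ∘ map V.from V.from) eq) (unmap _)))

module Transport {G H : Graph} (φ : G ≅ H) where
  private
    module G = Graph G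
    module H = Graph H
    module V = Inverse (_≅_.vertices φ)
    module E = Inverse (_≅_.edges φ)
  open _≅_ φ

  to-injective : Injective _≡_ _≡_ V.to
  to-injective = Injection.injective (↔⇒↣ vertices)

  incident⁺ : ∀ {v e} → G.Incident v e → H.Incident (V.to v) (E.to e)
  incident⁺ {e = e} inc with preservesEnds e | inc
  ... | inj₁ eq | inj₁ refl = inj₁ (sym (cong proj₁ eq))
  ... | inj₁ eq | inj₂ refl = inj₂ (sym (cong proj₂ eq))
  ... | inj₂ eq | inj₁ refl = inj₂ (sym (cong proj₂ eq))
  ... | inj₂ eq | inj₂ refl = inj₁ (sym (cong proj₁ eq))

  incident⁻ : ∀ {v e} → H.Incident (V.to v) (E.to e) → G.Incident v e
  incident⁻ {e = e} inc with preservesEnds e | inc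
  ... | inj₁ eq | inj₁ v≡ = inj₁ (to-injective (trans v≡ (cong proj₁ eq)))
  ... | inj₁ eq | inj₂ v≡ = inj₂ (to-injective (trans v≡ (cong proj₂ eq)))
  ... | inj₂ eq | inj₁ v≡ = inj₂ (to-injective (trans v≡ (cong proj₁ eq)))
  ... | inj₂ eq | inj₂ v≡ = inj₁ (to-injective (trans v≡ (cong proj₂ eq)))

  adjacent⁺ : ∀ {u v} → G.Adjacent u v → H.Adjacent (V.to u) (V.to v)
  adjacent⁺ (e , adj) with preservesEnds e | adj
  ... | inj₁ eq | inj₁ refl = E.to e , inj₁ eq
  ... | inj₁ eq | inj₂ refl = E.to e , inj₂ eq
  ... | inj₂ eq | inj₁ refl = E.to e , inj₂ eq
  ... | inj₂ eq | inj₂ refl = E.to e , inj₁ eq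

  abstract
    pullback : Subset H.size → Subset G.size
    pullback P = tabulate λ e → lookup P (E.to e)

    pullback⁺ : ∀ {P e} → E.to e ∈ P → e ∈ pullback P
    pullback⁺ {P} {e} e∈ = lookup⇒[]= e (pullback P) (trans (lookup∘tabulate _ e) ([]=⇒lookup e∈))

    pullback⁻ : ∀ {P e} → e ∈ pullback P → E.to e ∈ P
    pullback⁻ {P} {e} e∈ = lookup⇒[]= (E.to e) P (trans (sym (lookup∘tabulate _ e)) ([]=⇒lookup e∈))

  pullback-injective : ∀ {P Q} → pullback P ≡ pullback Q → P ≡ Q
  pullback-injective eq = subset-ext (half eq) (half (sym eq))
    where
    half : ∀ {P Q} → pullback P ≡ pullback Q → ∀ {f} → f ∈ P → f ∈ Q
    half {P} {Q} eq {f} f∈ = subst (_∈ Q) (E.strictlyInverseˡ f)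
      (pullback⁻ (subst (E.from f ∈_) eq (pullback⁺ (subst (_∈ P) (sym (E.strictlyInverseˡ f)) f∈))))

  pullback-matching : ∀ {P} → H.PerfectMatching P → G.PerfectMatching (pullback P)
  pullback-matching {P} pm v with f , (f∈ , inc) , unique ← pm (V.to v) =
    E.from f ,
    (pullback⁺ (subst (_∈ P) (sym (E.strictlyInverseˡ f)) f∈) ,
     incident⁻ (subst (H.Incident (V.to v)) (sym (E.strictlyInverseˡ f)) inc)) ,
    λ { {y} (y∈ , yinc) → trans (cong E.from (unique (pullback⁻ y∈ , incident⁺ yinc))) (E.strictlyInverseʳ y) }

  pullback-through : ∀ {P e} → H.PerfectMatchingThrough (E.to e) P → G.PerfectMatchingThrough e (pullback P)
  pullback-through (pm , e∈) = pullback-matching pm , pullback⁺ e∈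

-- Pulling back the two matchings of `H` leaves none out, because every matching of `G` is the
-- pullback of its own pushforward.
doubleCovered-resp-≅ : ∀ {G H} → G ≅ H → Graph.MatchingDoubleCovered H → Graph.MatchingDoubleCovered G
doubleCovered-resp-≅ {G} {H} φ (connected , two) = connected′ , two′
  where
  module G = Graph G
  module H = Graph H
  module V = Inverse (_≅_.vertices φ)
  module E = Inverse (_≅_.edges φ)
  open Transport φ using (pullback; pullback⁺; pullback⁻; pullback-injective; pullback-through)
  open Transport (≅-sym φ) using (adjacent⁺)
    renaming (pullback to pushforward; pullback⁺ to pushforward⁺; pullback⁻ to pushforward⁻;
              pullback-matching to pushforward-matching)

  connected′ : G.Connected
  connected′ u v = subst₂ (Star G.Adjacent) (V.strictlyInverseʳ u) (V.strictlyInverseʳ v)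
    (gmap V.from adjacent⁺ (connected (V.to u) (V.to v)))

  back : ∀ P → pullback (pushforward P) ≡ P
  back P = subset-ext
    (λ {e} e∈ → subst (_∈ P) (E.strictlyInverseʳ e) (pushforward⁻ (pullback⁻ e∈)))
    (λ {e} e∈ → pullback⁺ (pushforward⁺ (subst (_∈ P) (sym (E.strictlyInverseʳ e)) e∈)))

  two′ : ∀ e → G.InExactlyTwoPerfectMatchings e
  two′ e with M , N , M≢N , m , n , only ← two (E.to e) =
    pullback M , pullback N , (λ eq → M≢N (pullback-injective eq)) ,
    pullback-through m , pullback-through n ,
    λ { P (pm , e∈) → [ (λ eq → inj₁ (trans (sym (back P)) (cong pullback eq)))
                      , (λ eq → inj₂ (trans (sym (back P)) (cong pullback eq))) ]′
        (only (pushforward P) (pushforward-matching pm ,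
          pushforward⁺ (subst (_∈ P) (sym (E.strictlyInverseʳ e)) e∈))) }

-- Coordinates and the construction of the isomorphisms.

bijection : {A B : Set} (f : A → B) → Injective _≡_ _≡_ f → (∀ b → ∃ λ a → f a ≡ b) → A ↔ B
bijection f inj surj = mk↔ₛ′ f (λ b → proj₁ (surj b)) (λ b → proj₂ (surj b))
  (λ a → inj (proj₂ (surj (f a))))

-- Coordinates in the bipartite graph on Fin n ⊎ Fin n with m parallel edges
-- between any two vertices of different sides.
record Grid (n m : ℕ) (H : Graph) : Set where
  open Graph H
  field
    vertices : Vertex ↔ (Fin n ⊎ Fin n)
    edges    : Edge ↔ (Fin n × Fin n × Fin m)
    ends-≡   : ∀ e → let i , j , _ = Inverse.to edges e in
      map (Inverse.to vertices) (Inverse.to vertices) (ends e) ≡ (inj₁ i , inj₂ j) ⊎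
      map (Inverse.to vertices) (Inverse.to vertices) (ends e) ≡ (inj₂ j , inj₁ i)

K₃,₃-grid : Grid 3 1 K₃,₃
K₃,₃-grid = record
  { vertices = Fin.+↔⊎ {3} {3}
  ; edges    = mk↔ₛ′ (λ e → let i , j = remQuot {3} 3 e in i , j , 0F) (λ (i , j , _) → combine i j)
      (λ { (i , j , 0F) → cong (λ (a , b) → a , b , 0F) (Fin.remQuot-combine i j) })
      (λ e → Fin.combine-remQuot {3} 3 e)
  ; ends-≡   = λ e → let i , j = remQuot {3} 3 e in
      inj₁ (cong₂ _,_ (Fin.splitAt-↑ˡ 3 i 3) (Fin.splitAt-↑ʳ 3 3 j))
  }

-- Even vertices of the 4-cycle form the first side and odd ones the second. The cycle edges `1F`
-- and `3F` start at odd vertices, hence the `inj₂` clauses of `ends`.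
C₄⁴-grid : Grid 2 2 C₄⁴
C₄⁴-grid = record
  { vertices = mk↔ₛ′ vertex vertex⁻¹
      (λ { (inj₁ 0F) → refl ; (inj₁ 1F) → refl ; (inj₂ 0F) → refl ; (inj₂ 1F) → refl })
      (λ { 0F → refl ; 1F → refl ; 2F → refl ; 3F → refl })
  ; edges    = mk↔ₛ′ edge edge⁻¹ edge∘edge⁻¹ edge⁻¹∘edge
  ; ends-≡   = λ e → ends (quotient {4} 2 e)
  }
  where
  vertex : Fin 4 → Fin 2 ⊎ Fin 2
  vertex 0F = inj₁ 0F
  vertex 1F = inj₂ 0F
  vertex 2F = inj₁ 1F
  vertex 3F = inj₂ 1F

  vertex⁻¹ : Fin 2 ⊎ Fin 2 → Fin 4
  vertex⁻¹ (inj₁ 0F) = 0F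
  vertex⁻¹ (inj₂ 0F) = 1F
  vertex⁻¹ (inj₁ 1F) = 2F
  vertex⁻¹ (inj₂ 1F) = 3F

  row column : Fin 4 → Fin 2
  row 0F = 0F
  row 1F = 1F
  row 2F = 1F
  row 3F = 0F
  column 0F = 0F
  column 1F = 0F
  column 2F = 1F
  column 3F = 1F

  class : Fin 2 → Fin 2 → Fin 4
  class 0F 0F = 0F
  class 1F 0F = 1F
  class 1F 1F = 2F
  class 0F 1F = 3F

  ends : ∀ c → map vertex vertex (Graph.ends C₄ c) ≡ (inj₁ (row c) , inj₂ (column c)) ⊎
               map vertex vertex (Graph.ends C₄ c) ≡ (inj₂ (column c) , inj₁ (row c))
  ends 0F = inj₁ refl
  ends 1F = inj₂ refl
  ends 2F = inj₁ refl
  ends 3F = inj₂ refl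

  class-row-column : ∀ c → class (row c) (column c) ≡ c
  class-row-column 0F = refl
  class-row-column 1F = refl
  class-row-column 2F = refl
  class-row-column 3F = refl

  coordinates : Fin 4 × Fin 2 → Fin 2 × Fin 2 × Fin 2
  coordinates (c , k) = row c , column c , k

  coordinates-class : ∀ i j k → coordinates (class i j , k) ≡ (i , j , k)
  coordinates-class 0F 0F k = refl
  coordinates-class 0F 1F k = refl
  coordinates-class 1F 0F k = refl
  coordinates-class 1F 1F k = refl

  edge : Fin 8 → Fin 2 × Fin 2 × Fin 2
  edge e = coordinates (remQuot {4} 2 e)

  edge⁻¹ : Fin 2 × Fin 2 × Fin 2 → Fin 8
  edge⁻¹ (i , j , k) = combine (class i j) k

  edge∘edge⁻¹ : ∀ ijk → edge (edge⁻¹ ijk) ≡ ijk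
  edge∘edge⁻¹ (i , j , k) = trans (cong coordinates (Fin.remQuot-combine (class i j) k)) (coordinates-class i j k)

  edge⁻¹∘edge : ∀ e → edge⁻¹ (edge e) ≡ e
  edge⁻¹∘edge e = trans (cong (λ c → combine c (proj₂ (remQuot {4} 2 e))) (class-row-column (quotient {4} 2 e)))
    (Fin.combine-remQuot {4} 2 e)

module _ (G : Graph) (side : Graph.Vertex G → Bool)
  (proper : ∀ e → side (proj₁ (Graph.ends G e)) ≢ side (proj₂ (Graph.ends G e)))
  {M} (matching : Graph.PerfectMatching G M) where

  open Graph G
  open BipartiteMatching G side proper matching
  open Selections s t

  -- This undoes the contraction: a node splits into its vertex on the side `true` and the matching
  -- partner of that vertex, and an edge from `node i` to `node j` joins the former of `node i` to
  -- the latter of `node j`.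
  Table⇒≅ : ∀ {n m H} → Grid n m H → Table n m → G ≅ H
  Table⇒≅ {n} {m} {H} grid table = ≅-sym record
    { vertices      = ↔-trans (Grid.vertices grid) (bijection vertex vertex-injective vertex-surjective)
    ; edges         = ↔-trans (Grid.edges grid) (bijection cell cell-injective cell-surjective)
    ; preservesEnds = preserves
    }
    where
    open Table table
    module H = Graph H
    toV = Inverse.to (Grid.vertices grid)

    vertex : Fin n ⊎ Fin n → Vertex
    vertex (inj₁ i) = proj₁ (node i)
    vertex (inj₂ j) = end (ι (node j))

    sides-differ : ∀ {i j} → vertex (inj₁ i) ≢ vertex (inj₂ j)
    sides-differ {i} {j} eq = contradiction
      (trans (sym (proj₂ (node i))) (trans (cong side eq) (end-false (ι (node j))))) λ ()

    vertex-injective : Injective _≡_ _≡_ vertex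
    vertex-injective {inj₁ i} {inj₁ j} eq = cong inj₁ (node-injective (node≡ eq))
    vertex-injective {inj₁ i} {inj₂ j} eq = contradiction eq sides-differ
    vertex-injective {inj₂ i} {inj₁ j} eq = contradiction (sym eq) sides-differ
    vertex-injective {inj₂ i} {inj₂ j} eq = cong inj₂ (node-injective
      (trans (sym (t-ι (node i))) (trans (cong home eq) (t-ι (node j)))))

    vertex-surjective : ∀ v → ∃ λ i → vertex i ≡ v
    vertex-surjective v with side v in eq
    ... | true  = let i , hit = node-surjective (v , eq) in inj₁ i , cong proj₁ hit
    ... | false = let j , hit = node-surjective (home v) in
      inj₂ j , trans (cong (λ a → end (ι a)) hit) (home-end-ι eq)

    cell : Fin n × Fin n × Fin m → Edge
    cell (i , j , k) = edge i j k

    cell-injective : Injective _≡_ _≡_ cell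
    cell-injective {i , j , k} {i′ , j′ , k′} eq
      with refl ← node-injective (trans (sym (edge-source i j k)) (trans (cong s eq) (edge-source i′ j′ k′)))
         | refl ← node-injective (trans (sym (edge-target i j k)) (trans (cong t eq) (edge-target i′ j′ k′)))
      = cong (λ k → i , j , k) (edge-injective i j eq)

    cell-surjective : ∀ e → ∃ λ ijk → cell ijk ≡ e
    cell-surjective e = let i , j , k , hit = edge-surjective e in (i , j , k) , hit

    cell-ends : ∀ i j k → ends (edge i j k) ≡ (vertex (inj₁ i) , vertex (inj₂ j)) ⊎
                          ends (edge i j k) ≡ (vertex (inj₂ j) , vertex (inj₁ i))
    cell-ends i j k with ends≡ (edge i j k)
    ... | inj₁ eq = inj₁ (trans eq (cong₂ _,_ a b))
      where
      a = cong proj₁ (edge-source i j k)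
      b = trans (sym (end-t (edge i j k))) (cong (λ v → end (ι v)) (edge-target i j k))
    ... | inj₂ eq = inj₂ (trans eq (cong₂ _,_ b a))
      where
      a = cong proj₁ (edge-source i j k)
      b = trans (sym (end-t (edge i j k))) (cong (λ v → end (ι v)) (edge-target i j k))

    preserves : ∀ f → let uv = map (vertex ∘ toV) (vertex ∘ toV) (H.ends f)
                          e  = cell (Inverse.to (Grid.edges grid) f) in
      ends e ≡ uv ⊎ ends e ≡ swap uv
    preserves f with Inverse.to (Grid.edges grid) f | Grid.ends-≡ grid f
    ... | i , j , k | inj₁ eq =
      [ (λ same → inj₁ (trans same (sym uv≡)))
      , (λ reversed → inj₂ (trans reversed (cong swap (sym uv≡)))) ]′ (cell-ends i j k)
      where
      uv≡ : map (vertex ∘ toV) (vertex ∘ toV) (H.ends f) ≡ (vertex (inj₁ i) , vertex (inj₂ j))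
      uv≡ = cong (map vertex vertex) eq
    ... | i , j , k | inj₂ eq =
      [ (λ same → inj₂ (trans same (cong swap (sym uv≡))))
      , (λ reversed → inj₁ (trans reversed (sym uv≡))) ]′ (cell-ends i j k)
      where
      uv≡ : map (vertex ∘ toV) (vertex ∘ toV) (H.ends f) ≡ (vertex (inj₂ j) , vertex (inj₁ i))
      uv≡ = cong (map vertex vertex) eq

  someVertex : Vertex
  someVertex = fromNonZero nonNull
    where
    fromNonZero : ∀ {n} → NonZero n → Fin n
    fromNonZero {suc _} _ = zero

  doubleCovered⇒≅ : MatchingDoubleCovered → G ≅ K₃,₃ ⊎ G ≅ C₄⁴
  doubleCovered⇒≅ (connected , two) = [ inj₁ ∘ Table⇒≅ K₃,₃-grid , inj₂ ∘ Table⇒≅ C₄⁴-grid ]′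
    (connected⇒Table (home someVertex) (home-connected connected))
    where open DoubleCovered _≟ᴺ_ Fin._≟_ search node≡ s t ι s-ι t-ι (λ e → exactly-two (two e))

corollary1p7 : (G : Graph) → Graph.HasPerfectMatching G → Graph.Bipartite G →
    Graph.MatchingDoubleCovered G ⇔ (G ≅ K₃,₃ ⊎ G ≅ C₄⁴)
corollary1p7 G (_ , matching) (side , proper) = mk⇔ (doubleCovered⇒≅ G side proper matching)
  [ (λ φ → doubleCovered-resp-≅ φ (K₃,₃-connected , K₃,₃-exactlyTwo))
  , (λ φ → doubleCovered-resp-≅ φ (C₄⁴-connected , C₄⁴-exactlyTwo)) ]′
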